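{- Every maximum affine equiangular set in $L$ with norm $3$ with respect to the switching root $\rho$ is not strongly maximal.
   Context: Lattices. $A_n=\{x\in\mathbb{Z}^{n+1}: x_1+\cdots+x_{n+1}=0\}$ and $\alpha_n=(\frac1{n+1},\dots,\frac1{n+1},-\frac n{n+1})\in\mathbb{R}^{n+1}$ (so $\alpha_1=(\frac12,-\frac12)$). Let $\Lambda=A_5^3\oplus A_1^4\subset\mathbb{R}^{26}$; vectors of $\mathbb{R}^{26}$ are written $(v_1,\dots,v_7)$ with $v_1,v_2,v_3\in\mathbb{R}^6$ and $v_4,\dots,v_7\in\mathbb{R}^2$. Let $\beta_0=(\alpha_5,\alpha_5,\alpha_5,0,0,0,\alpha_1)$, $\beta_1=(3\alpha_5,0,0,0,\alpha_1,\alpha_1,\alpha_1)$, $\beta_2=(0,3\alpha_5,0,\alpha_1,0,\alpha_1,\alpha_1)$, $\beta_3=(0,0,3\alpha_5,\alpha_1,\alpha_1,0,\alpha_1)$. $L$ is the lattice generated by $\Lambda$ and $\beta_0,\beta_1,\beta_2,\beta_3$ (an integral lattice). Let $\rho=(0,0,0,0,0,0,2\alpha_1)$. Affine equiangular sets. A set $\omega$ of vectors in a Euclidean space containing $\rho$ is an affine equiangular set with norm $3$ with respect to the switching root $\rho$ if $(u,\rho)=1$ and $(u,u)=3$ for all $u\in\omega$, and $(u,v)\in\{0,1\}$ for all distinct $u,v\in\omega$, where $(\cdot,\cdot)$ is the inner product. It is in $L$ if $\omega\subset L$, and it is maximum in $L$ if no such set in $L$ has larger cardinality. An affine equiangular set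 $\omega$ with norm $3$ with respect to $\rho$ is strongly maximal if there is no affine equiangular set with norm $3$ with respect to $\rho$ properly containing $\omega$, even if the dimension of the underlying Euclidean space is increased (i.e. even when the ambient space is isometrically embedded in a Euclidean space of arbitrary larger finite dimension). -}

module Defs where

open import Algebra.Bundles using (CommutativeRing)
import Algebra.Properties.Monoid.Sum as MonoidSum
open import Data.Fin.Base using (Fin)
open import Data.Fin.Patterns using (0F; 1F; 2F; 3F)
open import Data.Integer.Base as ℤ using (ℤ; 0ℤ)
import Data.Integer.Properties as ℤ
open import Data.Nat.Base as ℕ using (ℕ; suc; _⊔_)
import Data.Nat.Properties as ℕ
open import Data.Product.Base using (∃; ∃-syntax; ∃₂; _×_; _,_; proj₁; proj₂)
open import Data.Rational.Base as ℚ using (ℚ; 0ℚ; 1ℚ; ½; ∣_∣; positive)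
import Data.Rational.Properties as ℚ
open import Data.Rational.Solver using (module +-*-Solver)
open import Data.Sum.Base using (_⊎_)
open import Data.Vec.Functional using (Vector; map; zipWith; replicate; _++_)
import Data.Vec.Functional.Relation.Binary.Equality.Setoid as VecEquality
open import Function.Bundles using (Injection)
open import Level using (0ℓ)
import Relation.Binary.Construct.On as On
open import Relation.Binary.Bundles using (Setoid)
open import Relation.Binary.Core using (_Preserves_⟶_)
open import Relation.Binary.Definitions using (_Respects_)
open import Relation.Binary.PropositionalEquality
  using (_≡_; _≗_; refl; sym; trans; cong; subst)
open import Relation.Nullary.Negation.Core using (¬_)
open import Relation.Unary using (Pred; _∈_; _⊆_; _⊂_; _∪_)

------------------------------------------------------------------------
-- The real numbers, as Cauchy sequences of rationals

-- Asymptotic equality with two independent indices: a sequence is Cauchy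
-- exactly when it is related to itself, and between Cauchy sequences the
-- relation says that the difference tends to 0.
infix 4 _~_

_~_ : (ℕ → ℚ) → (ℕ → ℚ) → Set
f ~ g = ∀ ε → 0ℚ ℚ.< ε →
  ∃[ N ] (∀ m n → N ℕ.≤ m → N ℕ.≤ n → ∣ f m ℚ.- g n ∣ ℚ.< ε)

record ℝ : Set where
  constructor mkℝ
  field
    seq    : ℕ → ℚ
    cauchy : seq ~ seq

open ℝ public

infix 4 _≈_

-- A record rather than a synonym, so that x and y can be inferred.
record _≈_ (x y : ℝ) : Set where
  constructor mk≈
  field
    close : seq x ~ seq y

open _≈_ public

~-reflexive : ∀ {f g} → f ~ f → f ≗ g → f ~ g
~-reflexive {f} c f≗g ε 0<ε with c ε 0<ε
... | N , h = N , λ m n N≤m N≤n →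
  subst (λ q → ∣ f m ℚ.- q ∣ ℚ.< ε) (f≗g n) (h m n N≤m N≤n)

~-sym : ∀ {f g} → f ~ g → g ~ f
~-sym {f} {g} c ε 0<ε with c ε 0<ε
... | N , h = N , λ m n N≤m N≤n →
  subst (ℚ._< ε) (∣p-q∣≡∣q-p∣ (f n) (g m)) (h n m N≤n N≤m)
  where
  ∣p-q∣≡∣q-p∣ : ∀ p q → ∣ p ℚ.- q ∣ ≡ ∣ q ℚ.- p ∣
  ∣p-q∣≡∣q-p∣ p q = trans (sym (ℚ.∣-p∣≡∣p∣ (p ℚ.- q)))
    (cong ∣_∣ (solve 2 (λ p q → :- (p :- q) := q :- p) refl p q))
    where open +-*-Solver

½ε>0 : ∀ {ε} → 0ℚ ℚ.< ε → 0ℚ ℚ.< ½ ℚ.* ε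
½ε>0 {ε} 0<ε = ℚ.positive⁻¹ (½ ℚ.* ε) {{ℚ.pos*pos⇒pos ½ ε {{positive 0<ε}}}}

½ε+½ε : ∀ ε → ½ ℚ.* ε ℚ.+ ½ ℚ.* ε ≡ ε
½ε+½ε ε = trans (sym (ℚ.*-distribʳ-+ ε ½ ½)) (ℚ.*-identityˡ ε)

∣+∣<ε : ∀ {ε p q r} → r ≡ p ℚ.+ q →
        ∣ p ∣ ℚ.< ½ ℚ.* ε → ∣ q ∣ ℚ.< ½ ℚ.* ε → ∣ r ∣ ℚ.< ε
∣+∣<ε {ε} {p} {q} refl p< q< = ℚ.≤-<-trans (ℚ.∣p+q∣≤∣p∣+∣q∣ p q)
  (subst (∣ p ∣ ℚ.+ ∣ q ∣ ℚ.<_) (½ε+½ε ε) (ℚ.+-mono-< p< q<))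

~-trans : ∀ {f g h} → f ~ g → g ~ h → f ~ h
~-trans {f} {g} {h} f~g g~h ε 0<ε
  with f~g (½ ℚ.* ε) (½ε>0 0<ε) | g~h (½ ℚ.* ε) (½ε>0 0<ε)
... | M , p | N , q = M ⊔ N , λ m n ≤m ≤n →
  ∣+∣<ε (solve 3 (λ a b c → a :- c := (a :- b) :+ (b :- c)) refl (f m) (g (M ⊔ N)) (h n))
        (p m (M ⊔ N) (ℕ.m⊔n≤o⇒m≤o M N ≤m) (ℕ.m≤m⊔n M N))
        (q (M ⊔ N) n (ℕ.m≤n⊔m M N) (ℕ.m⊔n≤o⇒n≤o M N ≤n))
  where open +-*-Solver

~-+ : ∀ {f f′ g g′} → f ~ f′ → g ~ g′ → (λ n → f n ℚ.+ g n) ~ (λ n → f′ n ℚ.+ g′ n)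
~-+ {f} {f′} {g} {g′} f~ g~ ε 0<ε
  with f~ (½ ℚ.* ε) (½ε>0 0<ε) | g~ (½ ℚ.* ε) (½ε>0 0<ε)
... | M , p | N , q = M ⊔ N , λ m n ≤m ≤n →
  ∣+∣<ε (solve 4 (λ a b c d → (a :+ c) :- (b :+ d) := (a :- b) :+ (c :- d)) refl
          (f m) (f′ n) (g m) (g′ n))
        (p m n (ℕ.m⊔n≤o⇒m≤o M N ≤m) (ℕ.m⊔n≤o⇒m≤o M N ≤n))
        (q m n (ℕ.m⊔n≤o⇒n≤o M N ≤m) (ℕ.m⊔n≤o⇒n≤o M N ≤n))
  where open +-*-Solver

~-neg : ∀ {f f′} → f ~ f′ → (λ n → ℚ.- f n) ~ (λ n → ℚ.- f′ n)
~-neg {f} {f′} f~ ε 0<ε with f~ ε 0<ε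
... | N , p = N , λ m n N≤m N≤n → subst (ℚ._< ε)
  (trans (sym (ℚ.∣-p∣≡∣p∣ (f m ℚ.- f′ n)))
         (cong ∣_∣ (ℚ.neg-distrib-+ (f m) (ℚ.- f′ n))))
  (p m n N≤m N≤n)

~-bounded : ∀ {f g} → f ~ g → ∃₂ λ B N → 0ℚ ℚ.< B × (∀ n → N ℕ.≤ n → ∣ f n ∣ ℚ.< B)
~-bounded {f} {g} f~g with f~g 1ℚ (ℚ.positive⁻¹ 1ℚ)
... | N , p = 1ℚ ℚ.+ ∣ g N ∣ , N
            , ℚ.+-mono-<-≤ {0ℚ} {1ℚ} {0ℚ} (ℚ.positive⁻¹ 1ℚ) (ℚ.0≤∣p∣ (g N))
            , λ n N≤n → ℚ.≤-<-trans
                (subst (λ q → ∣ q ∣ ℚ.≤ ∣ f n ℚ.- g N ∣ ℚ.+ ∣ g N ∣)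
                  (solve 2 (λ a b → (a :- b) :+ b := a) refl (f n) (g N))
                  (ℚ.∣p+q∣≤∣p∣+∣q∣ (f n ℚ.- g N) (g N)))
                (ℚ.+-monoˡ-< ∣ g N ∣ (p n N N≤n ℕ.≤-refl))
  where open +-*-Solver

ac-bd≡ : ∀ a b c d → a ℚ.* c ℚ.- b ℚ.* d ≡ a ℚ.* (c ℚ.- d) ℚ.+ d ℚ.* (a ℚ.- b)
ac-bd≡ = solve 4 (λ a b c d → a :* c :- b :* d := a :* (c :- d) :+ d :* (a :- b)) refl
  where open +-*-Solver

inv : ∀ C → 0ℚ ℚ.< C → ℚ
inv C 0<C = (ℚ.1/ C) {{ℚ.pos⇒nonZero C {{positive 0<C}}}}

scale : ∀ ε C → 0ℚ ℚ.< C → ℚ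
scale ε C 0<C = inv C 0<C ℚ.* (½ ℚ.* ε)

scale>0 : ∀ {ε} C (0<C : 0ℚ ℚ.< C) → 0ℚ ℚ.< ε → 0ℚ ℚ.< scale ε C 0<C
scale>0 {ε} C 0<C 0<ε = ℚ.positive⁻¹ (scale ε C 0<C)
  {{ℚ.pos*pos⇒pos (inv C 0<C) {{ℚ.1/pos⇒pos C {{positive 0<C}}}}
                  (½ ℚ.* ε) {{positive (½ε>0 0<ε)}}}}

∣*∣<½ε : ∀ {ε C p q} (0<C : 0ℚ ℚ.< C) → ∣ p ∣ ℚ.< C →
         ∣ q ∣ ℚ.< scale ε C 0<C → ∣ p ℚ.* q ∣ ℚ.< ½ ℚ.* ε
∣*∣<½ε {ε} {C} {p} {q} 0<C p< q< = begin-strict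
  ∣ p ℚ.* q ∣                        ≡⟨ ℚ.∣p*q∣≡∣p∣*∣q∣ p q ⟩
  ∣ p ∣ ℚ.* ∣ q ∣                    ≤⟨ ℚ.*-monoʳ-≤-nonNeg ∣ q ∣ {{ℚ.∣-∣-nonNeg q}} (ℚ.<⇒≤ p<) ⟩
  C ℚ.* ∣ q ∣                        <⟨ ℚ.*-monoʳ-<-pos C {{positive 0<C}} q< ⟩
  C ℚ.* (inv C 0<C ℚ.* (½ ℚ.* ε))    ≡⟨ ℚ.*-assoc C (inv C 0<C) (½ ℚ.* ε) ⟨
  C ℚ.* inv C 0<C ℚ.* (½ ℚ.* ε)      ≡⟨ cong (ℚ._* (½ ℚ.* ε))
                                          (ℚ.*-inverseʳ C {{ℚ.pos⇒nonZero C {{positive 0<C}}}}) ⟩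
  1ℚ ℚ.* (½ ℚ.* ε)                   ≡⟨ ℚ.*-identityˡ (½ ℚ.* ε) ⟩
  ½ ℚ.* ε                            ∎
  where open ℚ.≤-Reasoning

~-* : ∀ {f f′ g g′} → f ~ f′ → g ~ g′ → (λ n → f n ℚ.* g n) ~ (λ n → f′ n ℚ.* g′ n)
~-* {f} {f′} {g} {g′} f~ g~ ε 0<ε =
  let B , K , 0<B , ∣f∣<B  = ~-bounded {f} {f′} f~
      D , J , 0<D , ∣g′∣<D = ~-bounded {g′} {g} (~-sym {g} {g′} g~)
      M , p = g~ (scale ε B 0<B) (scale>0 B 0<B 0<ε)
      N , q = f~ (scale ε D 0<D) (scale>0 D 0<D 0<ε)
      KJ : ∀ {i} → (K ⊔ J) ⊔ (M ⊔ N) ℕ.≤ i → K ⊔ J ℕ.≤ i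
      KJ = ℕ.m⊔n≤o⇒m≤o (K ⊔ J) (M ⊔ N)
      MN : ∀ {i} → (K ⊔ J) ⊔ (M ⊔ N) ℕ.≤ i → M ⊔ N ℕ.≤ i
      MN = ℕ.m⊔n≤o⇒n≤o (K ⊔ J) (M ⊔ N)
  in (K ⊔ J) ⊔ (M ⊔ N) , λ m n ≤m ≤n →
  ∣+∣<ε {ε} {f m ℚ.* (g m ℚ.- g′ n)} {g′ n ℚ.* (f m ℚ.- f′ n)}
    (ac-bd≡ (f m) (f′ n) (g m) (g′ n))
    (∣*∣<½ε {ε} {B} {f m} {g m ℚ.- g′ n} 0<B (∣f∣<B m (ℕ.m⊔n≤o⇒m≤o K J (KJ ≤m)))
       (p m n (ℕ.m⊔n≤o⇒m≤o M N (MN ≤m)) (ℕ.m⊔n≤o⇒m≤o M N (MN ≤n))))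
    (∣*∣<½ε {ε} {D} {g′ n} {f m ℚ.- f′ n} 0<D (∣g′∣<D n (ℕ.m⊔n≤o⇒n≤o K J (KJ ≤n)))
       (q m n (ℕ.m⊔n≤o⇒n≤o M N (MN ≤m)) (ℕ.m⊔n≤o⇒n≤o M N (MN ≤n))))

infixl 6 _+_
infixl 7 _*_
infix  8 -_

-- Defined by copatterns, so that x + y unfolds only under seq or cauchy.
_+_ _*_ : ℝ → ℝ → ℝ
seq    (x + y) n = seq x n ℚ.+ seq y n
cauchy (x + y)   = ~-+ {seq x} {seq x} {seq y} {seq y} (cauchy x) (cauchy y)
seq    (x * y) n = seq x n ℚ.* seq y n
cauchy (x * y)   = ~-* {seq x} {seq x} {seq y} {seq y} (cauchy x) (cauchy y)

-_ : ℝ → ℝ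
seq    (- x) n = ℚ.- seq x n
cauchy (- x)   = ~-neg {seq x} {seq x} (cauchy x)

fromℚ : ℚ → ℝ
seq    (fromℚ p) _      = p
cauchy (fromℚ p) ε 0<ε = 0 , λ _ _ _ _ →
  subst (λ q → ∣ q ∣ ℚ.< ε) (sym (ℚ.+-inverseʳ p)) 0<ε

fromℤ : ℤ → ℝ
fromℤ z = fromℚ (z ℚ./ 1)

0ℝ 1ℝ : ℝ
0ℝ = fromℚ 0ℚ
1ℝ = fromℚ 1ℚ

≗⇒≈ : ∀ {x y} → seq x ≗ seq y → x ≈ y
≗⇒≈ {x} {y} x≗y = mk≈ (~-reflexive {seq x} {seq y} (cauchy x) x≗y)

≈-refl : ∀ {x} → x ≈ x
≈-refl {x} = mk≈ (cauchy x)

≈-sym : ∀ {x y} → x ≈ y → y ≈ x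
≈-sym {x} {y} p = mk≈ (~-sym {seq x} {seq y} (close p))

≈-trans : ∀ {x y z} → x ≈ y → y ≈ z → x ≈ z
≈-trans {x} {y} {z} p q = mk≈ (~-trans {seq x} {seq y} {seq z} (close p) (close q))

+-cong : ∀ {x x′ y y′} → x ≈ x′ → y ≈ y′ → x + y ≈ x′ + y′
+-cong {x} {x′} {y} {y′} p q =
  mk≈ (~-+ {seq x} {seq x′} {seq y} {seq y′} (close p) (close q))

*-cong : ∀ {x x′ y y′} → x ≈ x′ → y ≈ y′ → x * y ≈ x′ * y′
*-cong {x} {x′} {y} {y′} p q =
  mk≈ (~-* {seq x} {seq x′} {seq y} {seq y′} (close p) (close q))

-‿cong : ∀ {x x′} → x ≈ x′ → - x ≈ - x′
-‿cong {x} {x′} p = mk≈ (~-neg {seq x} {seq x′} (close p))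

+-assoc : ∀ x y z → (x + y) + z ≈ x + (y + z)
+-assoc x y z = ≗⇒≈ λ n → ℚ.+-assoc (seq x n) (seq y n) (seq z n)

+-comm : ∀ x y → x + y ≈ y + x
+-comm x y = ≗⇒≈ λ n → ℚ.+-comm (seq x n) (seq y n)

+-identityˡ : ∀ x → 0ℝ + x ≈ x
+-identityˡ x = ≗⇒≈ λ n → ℚ.+-identityˡ (seq x n)

+-inverseˡ : ∀ x → - x + x ≈ 0ℝ
+-inverseˡ x = ≗⇒≈ λ n → ℚ.+-inverseˡ (seq x n)

*-assoc : ∀ x y z → (x * y) * z ≈ x * (y * z)
*-assoc x y z = ≗⇒≈ λ n → ℚ.*-assoc (seq x n) (seq y n) (seq z n)

*-comm : ∀ x y → x * y ≈ y * x
*-comm x y = ≗⇒≈ λ n → ℚ.*-comm (seq x n) (seq y n)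

*-identityˡ : ∀ x → 1ℝ * x ≈ x
*-identityˡ x = ≗⇒≈ λ n → ℚ.*-identityˡ (seq x n)

*-distribˡ-+ : ∀ x y z → x * (y + z) ≈ x * y + x * z
*-distribˡ-+ x y z = ≗⇒≈ λ n → ℚ.*-distribˡ-+ (seq x n) (seq y n) (seq z n)

*-distribʳ-+ : ∀ x y z → (y + z) * x ≈ y * x + z * x
*-distribʳ-+ x y z = ≗⇒≈ λ n → ℚ.*-distribʳ-+ (seq x n) (seq y n) (seq z n)

ℝ-commutativeRing : CommutativeRing 0ℓ 0ℓ
ℝ-commutativeRing = record
  { Carrier = ℝ ; _≈_ = _≈_ ; _+_ = _+_ ; _*_ = _*_ ; -_ = -_ ; 0# = 0ℝ ; 1# = 1ℝ
  ; isCommutativeRing = record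
    { isRing = record
      { +-isAbelianGroup = record
        { isGroup = record
          { isMonoid = record
            { isSemigroup = record
              { isMagma = record
                { isEquivalence = record { refl = ≈-refl ; sym = ≈-sym ; trans = ≈-trans }
                ; ∙-cong        = +-cong
                }
              ; assoc = +-assoc
              }
            ; identity = +-identityˡ , λ x → ≈-trans (+-comm x 0ℝ) (+-identityˡ x)
            }
          ; inverse = +-inverseˡ , λ x → ≈-trans (+-comm x (- x)) (+-inverseˡ x)
          ; ⁻¹-cong = -‿cong
          }
        ; comm = +-comm
        }
      ; *-cong     = *-cong
      ; *-assoc    = *-assoc
      ; *-identity = *-identityˡ , λ x → ≈-trans (*-comm x 1ℝ) (*-identityˡ x)
      ; distrib    = *-distribˡ-+ , *-distribʳ-+
      }
    ; *-comm = *-comm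
    }
  }

------------------------------------------------------------------------
-- Euclidean spaces

ℝ^ : ℕ → Set
ℝ^ = Vector ℝ

open VecEquality (CommutativeRing.setoid ℝ-commutativeRing) public
  using (_≋_; ≋-setoid)
open MonoidSum (CommutativeRing.+-monoid ℝ-commutativeRing) public
  using (sum)
open MonoidSum ℤ.+-0-monoid public
  using () renaming (sum to sumℤ)

infixl 6 _+ᵥ_
infix  8 -ᵥ_
infixr 7 _·_

𝟎 : ∀ {n} → ℝ^ n
𝟎 {n} = replicate n 0ℝ

_+ᵥ_ : ∀ {n} → ℝ^ n → ℝ^ n → ℝ^ n
_+ᵥ_ = zipWith _+_

-ᵥ_ : ∀ {n} → ℝ^ n → ℝ^ n
-ᵥ_ = map (-_)

_·_ : ∀ {n} → ℝ → ℝ^ n → ℝ^ n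
c · v = map (c *_) v

⟨_,_⟩ : ∀ {n} → ℝ^ n → ℝ^ n → ℝ
⟨ u , v ⟩ = sum (zipWith _*_ u v)

record IsIsometricEmbedding {m n} (ι : ℝ^ m → ℝ^ n) : Set where
  field
    cong-≋ : ι Preserves _≋_ ⟶ _≋_
    +-homo : ∀ u v → ι (u +ᵥ v) ≋ ι u +ᵥ ι v
    ·-homo : ∀ c v → ι (c · v) ≋ c · ι v
    ⟨⟩-preserved : ∀ u v → ⟨ ι u , ι v ⟩ ≈ ⟨ u , v ⟩

------------------------------------------------------------------------
-- Sets of vectors and their cardinalities

image : ∀ {m n} → (ℝ^ m → ℝ^ n) → Pred (ℝ^ m) 0ℓ → Pred (ℝ^ n) 0ℓ
image ι ω v = ∃[ u ] u ∈ ω × v ≋ ι u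

subsetoid : ∀ {n} → Pred (ℝ^ n) 0ℓ → Setoid 0ℓ 0ℓ
subsetoid {n} ω = On.setoid {B = ∃ ω} (≋-setoid n) proj₁

-- Comparison of arbitrary cardinals; no finiteness is assumed.
_hasSmallerCardinalityThan_ : ∀ {m n} → Pred (ℝ^ m) 0ℓ → Pred (ℝ^ n) 0ℓ → Set
ω hasSmallerCardinalityThan ω′ =
  Injection (subsetoid ω) (subsetoid ω′) × ¬ Injection (subsetoid ω′) (subsetoid ω)

------------------------------------------------------------------------
-- Affine equiangular sets of norm 3

record IsAffineEquiangular {n} (ρ : ℝ^ n) (ω : Pred (ℝ^ n) 0ℓ) : Set where
  field
    respects : ω Respects _≋_
    affine   : ∀ {u} → u ∈ ω → ⟨ u , ρ ⟩ ≈ 1ℝ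
    norm     : ∀ {u} → u ∈ ω → ⟨ u , u ⟩ ≈ fromℤ (ℤ.+ 3)
    distinct : ∀ {u v} → u ∈ ω → v ∈ ω → ¬ u ≋ v → ⟨ u , v ⟩ ≈ 0ℝ ⊎ ⟨ u , v ⟩ ≈ 1ℝ

record IsMaximumIn {n} (L : Pred (ℝ^ n) 0ℓ) (ρ : ℝ^ n) (ω : Pred (ℝ^ n) 0ℓ) : Set₁ where
  field
    isAffineEquiangular : IsAffineEquiangular ρ ω
    ω⊆L                 : ω ⊆ L
    noLarger            : ∀ ω′ → IsAffineEquiangular ρ ω′ → ω′ ⊆ L →
                          ¬ (ω hasSmallerCardinalityThan ω′)

StronglyMaximal : ∀ {m} (ρ : ℝ^ m) (ω : Pred (ℝ^ m) 0ℓ) → Set₁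
StronglyMaximal {m} ρ ω =
  ∀ n (ι : ℝ^ m → ℝ^ n) → IsIsometricEmbedding ι →
  ¬ (∃[ ω′ ] IsAffineEquiangular (ι ρ) ω′ × image ι ω ⊂ ω′)

------------------------------------------------------------------------
-- The lattice L and the switching root ρ

data ⟪_⟫ {n} (G : Pred (ℝ^ n) 0ℓ) : Pred (ℝ^ n) 0ℓ where
  generator  : ∀ {v} → v ∈ G → v ∈ ⟪ G ⟫
  𝟎-closed   : 𝟎 ∈ ⟪ G ⟫
  +-closed   : ∀ {u v} → u ∈ ⟪ G ⟫ → v ∈ ⟪ G ⟫ → u +ᵥ v ∈ ⟪ G ⟫
  neg-closed : ∀ {v} → v ∈ ⟪ G ⟫ → -ᵥ v ∈ ⟪ G ⟫
  ≋-closed   : ∀ {u v} → u ≋ v → u ∈ ⟪ G ⟫ → v ∈ ⟪ G ⟫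

A : ∀ n → Pred (ℝ^ (n ℕ.+ 1)) 0ℓ
A n v = ∃[ z ] sumℤ z ≡ 0ℤ × v ≋ map fromℤ z

α : ∀ n → ℝ^ (n ℕ.+ 1)
α n = replicate n (fromℚ (ℤ.+ 1 ℚ./ suc n)) ++ replicate 1 (fromℚ (ℤ.- (ℤ.+ n) ℚ./ suc n))

blocks : (v₁ v₂ v₃ : ℝ^ 6) (v₄ v₅ v₆ v₇ : ℝ^ 2) → ℝ^ 26
blocks v₁ v₂ v₃ v₄ v₅ v₆ v₇ = v₁ ++ v₂ ++ v₃ ++ v₄ ++ v₅ ++ v₆ ++ v₇

Λ : Pred (ℝ^ 26) 0ℓ
Λ v = ∃₂ λ (a : Vector (ℝ^ 6) 3) (b : Vector (ℝ^ 2) 4) →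
  (∀ i → a i ∈ A 5) × (∀ i → b i ∈ A 1) ×
  v ≋ blocks (a 0F) (a 1F) (a 2F) (b 0F) (b 1F) (b 2F) (b 3F)

3α₅ : ℝ^ 6
3α₅ = fromℤ (ℤ.+ 3) · α 5

β : Fin 4 → ℝ^ 26
β 0F = blocks (α 5) (α 5) (α 5) 𝟎     𝟎     𝟎     (α 1)
β 1F = blocks 3α₅   𝟎     𝟎     𝟎     (α 1) (α 1) (α 1)
β 2F = blocks 𝟎     3α₅   𝟎     (α 1) 𝟎     (α 1) (α 1)
β 3F = blocks 𝟎     𝟎     3α₅   (α 1) (α 1) 𝟎     (α 1)

L : Pred (ℝ^ 26) 0ℓ
L = ⟪ Λ ∪ (λ v → ∃[ i ] v ≋ β i) ⟫

ρ : ℝ^ 26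
ρ = blocks 𝟎 𝟎 𝟎 𝟎 𝟎 𝟎 (fromℤ (ℤ.+ 2) · α 1)

{-# OPTIONS --safe #-}

-- Let u = (v₁, v₂, v₃, (a₄, -a₄), (a₅, -a₅), (a₆, -a₆), α₁) be a vector of L of norm 3 with (u, ρ) = 1,
-- and let S be one of the ten splittings of {1, …, 6} into two triples, with sign vector η ∈ {±1}⁶.
-- The vector w = (½η, 0, 0, (1, 0), 0, 0, α₁) of ℝ²⁶ is not in L, has norm 3 and (w, ρ) = 1, and
-- (u, w) ∈ {0, 1} unless u = (±½η, 0, 0, 0, ±α₁, ±α₁, α₁).  Hence an affine equiangular set in L can be
-- enlarged inside ℝ²⁶ as soon as it avoids these exceptional vectors for one S.  If it meets them for
-- all ten S, colour S by the signs of α₁ in the fifth and sixth block relative to the sign of η.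
-- The splittings are the edges of K₅, and exceptional vectors of the same colour on two edges with a
-- common vertex have inner product 2 or -1; but K₅ has no proper edge colouring with four colours.

module Submission where

open import Defs hiding (_+_; _*_; -_)
import Defs as R
open import Algebra.Bundles using (CommutativeRing)
import Algebra.Properties.CommutativeSemigroup as CommutativeSemigroupProperties
import Algebra.Properties.Group as GroupProperties
open import Data.Bool.Base using (if_then_else_)
open import Data.Fin.Base as Fin using (Fin; zero; suc; splitAt; toℕ; fromℕ<; combine)
open import Data.Fin.Patterns using (0F; 1F; 2F; 3F; 4F; 5F; 6F; 7F; 8F; 9F)
import Data.Fin.Properties as Fin
open import Data.Fin.Properties using (all?; any?; toℕ-fromℕ<)
open import Data.Integer.Base
  using (ℤ; +_; -[1+_]; 0ℤ; 1ℤ; _+_; _*_; -_; _-_; ∣_∣; _≤_; +≤+; _⊔_)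
open import Data.Integer.Divisibility.Signed using (_∣_; divides; _∣?_; ∣m∣n⇒∣m+n; ∣m+n∣n⇒∣m)
import Data.Integer.Properties as ℤ
open import Algebra.Properties.CommutativeMonoid.Sum ℤ.+-0-commutativeMonoid
  using () renaming (sum-cong-≗ to sum-cong; ∑-distrib-+ to sum-+)
open import Data.Integer.Solver using (module +-*-Solver)
open import Data.Integer.Tactic.RingSolver using (solve-∀)
open import Data.Nat.Base as ℕ using (ℕ)
import Data.Nat.Properties as ℕ
open import Data.Product.Base using (∃; _×_; _,_; proj₁; proj₂)
open import Data.Rational.Base as ℚ using (ℚ; 0ℚ; 1ℚ)
import Data.Rational.Properties as ℚ
open import Algebra.Definitions.RawMonoid ℚ.+-0-rawMonoid using () renaming (sum to sumℚ)
open import Data.Rational.Unnormalised.Base as ℚᵘ using (mkℚᵘ; *≡*)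
import Data.Rational.Unnormalised.Properties as ℚᵘ
open import Data.Sum.Base as Sum using (_⊎_; inj₁; inj₂)
open import Data.Vec.Functional using (Vector; zipWith; _++_; tail; map; replicate; foldr)
open import Data.Vec.Functional.Properties using (++-cong)
open import Effect.Monad using (RawMonad)
open import Function.Base using (_∘_)
open import Level using (0ℓ)
open import Relation.Binary.PropositionalEquality
  using (_≡_; _≗_; refl; sym; trans; cong; cong₂; subst; subst₂; module ≡-Reasoning)
import Relation.Binary.Reasoning.Setoid as SetoidReasoning
open import Relation.Nullary.Decidable
  using (Dec; does; yes; no; ¬?; toWitness; from-no; decidable-stable; _→-dec_; _×-dec_; _⊎-dec_)
open import Relation.Nullary.Negation using (¬¬-Monad)
open import Relation.Nullary.Negation.Core using (¬_; contradiction)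
open import Relation.Unary using (Pred; _∈_; _⊆_; _⊂_)

-- Integers among the rationals and rationals among the reals.

fromℚ-injective : ∀ {p q} → fromℚ p ≈ fromℚ q → p ≡ q
fromℚ-injective {p} {q} p≈q = decidable-stable (p ℚ.≟ q) λ p≢q →
  -- For ε = |p - q| > 0, closeness would give |p - q| < |p - q|.
  let ∣p-q∣≢0 = p≢q ∘ x∙y⁻¹≈ε⇒x≈y p q ∘ ℚ.∣p∣≡0⇒p≡0 (p ℚ.- q)
      N , ∣p-q∣< = close p≈q ℚ.∣ p ℚ.- q ∣ (ℚ.≰⇒> λ ∣p-q∣≤0 → ∣p-q∣≢0 (ℚ.≤-antisym ∣p-q∣≤0 (ℚ.0≤∣p∣ (p ℚ.- q))))
  in ℚ.<-irrefl refl (∣p-q∣< N N ℕ.≤-refl ℕ.≤-refl)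
  where open GroupProperties ℚ.+-0-group using (x∙y⁻¹≈ε⇒x≈y)

/1-injective : ∀ {z w} → z ℚ./ 1 ≡ w ℚ./ 1 → z ≡ w
/1-injective {z} {w} z/1≡w/1
  with *≡* z*1≡w*1 ← ℚ./-injective-≃ (mkℚᵘ z 0) (mkℚᵘ w 0) z/1≡w/1
  = trans (sym (ℤ.*-identityʳ z)) (trans z*1≡w*1 (ℤ.*-identityʳ w))

-- Division in `ℚ` normalises by a gcd that is stuck on variables, so the homomorphism laws are
-- verified on unnormalised fractions.
/1-+ : ∀ z w → (z + w) ℚ./ 1 ≡ z ℚ./ 1 ℚ.+ w ℚ./ 1
/1-+ z w = ℚ.toℚᵘ-injective (begin
  ℚ.toℚᵘ ((z + w) ℚ./ 1)                      ≈⟨ ℚ.toℚᵘ-fromℚᵘ (mkℚᵘ (z + w) 0) ⟩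
  mkℚᵘ (z + w) 0                               ≡⟨ cong₂ (λ x y → mkℚᵘ (x + y) 0) (ℤ.*-identityʳ z) (ℤ.*-identityʳ w) ⟨
  mkℚᵘ z 0 ℚᵘ.+ mkℚᵘ w 0                       ≈⟨ ℚᵘ.+-cong (ℚ.toℚᵘ-fromℚᵘ (mkℚᵘ z 0)) (ℚ.toℚᵘ-fromℚᵘ (mkℚᵘ w 0)) ⟨
  ℚ.toℚᵘ (z ℚ./ 1) ℚᵘ.+ ℚ.toℚᵘ (w ℚ./ 1)       ≈⟨ ℚ.toℚᵘ-homo-+ (z ℚ./ 1) (w ℚ./ 1) ⟨
  ℚ.toℚᵘ (z ℚ./ 1 ℚ.+ w ℚ./ 1)                 ∎)
  where open SetoidReasoning ℚᵘ.≃-setoid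

/1-* : ∀ z w → (z * w) ℚ./ 1 ≡ (z ℚ./ 1) ℚ.* (w ℚ./ 1)
/1-* z w = ℚ.toℚᵘ-injective (begin
  ℚ.toℚᵘ ((z * w) ℚ./ 1)                      ≈⟨ ℚ.toℚᵘ-fromℚᵘ (mkℚᵘ (z * w) 0) ⟩
  mkℚᵘ z 0 ℚᵘ.* mkℚᵘ w 0                       ≈⟨ ℚᵘ.*-cong (ℚ.toℚᵘ-fromℚᵘ (mkℚᵘ z 0)) (ℚ.toℚᵘ-fromℚᵘ (mkℚᵘ w 0)) ⟨
  ℚ.toℚᵘ (z ℚ./ 1) ℚᵘ.* ℚ.toℚᵘ (w ℚ./ 1)       ≈⟨ ℚ.toℚᵘ-homo-* (z ℚ./ 1) (w ℚ./ 1) ⟨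
  ℚ.toℚᵘ ((z ℚ./ 1) ℚ.* (w ℚ./ 1))             ∎)
  where open SetoidReasoning ℚᵘ.≃-setoid

/1-neg : ∀ z → (- z) ℚ./ 1 ≡ ℚ.- (z ℚ./ 1)
/1-neg z = ℚ.toℚᵘ-injective (begin
  ℚ.toℚᵘ ((- z) ℚ./ 1)       ≈⟨ ℚ.toℚᵘ-fromℚᵘ (mkℚᵘ (- z) 0) ⟩
  ℚᵘ.- mkℚᵘ z 0              ≈⟨ ℚᵘ.-‿cong (ℚ.toℚᵘ-fromℚᵘ (mkℚᵘ z 0)) ⟨
  ℚᵘ.- ℚ.toℚᵘ (z ℚ./ 1)      ≈⟨ ℚ.toℚᵘ-homo‿- (z ℚ./ 1) ⟨
  ℚ.toℚᵘ (ℚ.- (z ℚ./ 1))     ∎)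
  where open SetoidReasoning ℚᵘ.≃-setoid

-- Rational values of real inner products

-- Vector arguments are passed explicitly because unification of reals compares their Cauchy proofs.
+-value : ∀ {x y p q} → x ≈ fromℚ p → y ≈ fromℚ q → x R.+ y ≈ fromℚ (p ℚ.+ q)
+-value {x} {y} {p} {q} x≈p y≈q =
  mk≈ (~-+ {seq x} {λ _ → p} {seq y} {λ _ → q} (close x≈p) (close y≈q))

*-value : ∀ {x y p q} → x ≈ fromℚ p → y ≈ fromℚ q → x R.* y ≈ fromℚ (p ℚ.* q)
*-value {x} {y} {p} {q} x≈p y≈q =
  mk≈ (~-* {seq x} {λ _ → p} {seq y} {λ _ → q} (close x≈p) (close y≈q))

neg-value : ∀ {x p} → x ≈ fromℚ p → R.- x ≈ fromℚ (ℚ.- p)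
neg-value {x} {p} x≈p = mk≈ (~-neg {seq x} {λ _ → p} (close x≈p))

value-subst : ∀ {x p q} → x ≈ fromℚ p → p ≡ q → x ≈ fromℚ q
value-subst x≈p refl = x≈p

sum-value : ∀ {n} {x : ℝ^ n} {p : Vector ℚ n} → (∀ i → x i ≈ fromℚ (p i)) → sum x ≈ fromℚ (sumℚ p)
sum-value {ℕ.zero}  _ = mk≈ (cauchy 0ℝ)
sum-value {ℕ.suc n} {x} {p} x≈p = mk≈
  (~-+ {seq (x zero)} {λ _ → p zero} {seq (sum (tail x))} {λ _ → sumℚ (tail p)}
    (close (x≈p zero)) (close (sum-value {n} {tail x} {tail p} (x≈p ∘ suc))))

⟨⟩-value : ∀ {n} {u v : ℝ^ n} {p q : Vector ℚ n} →
           (∀ i → u i ≈ fromℚ (p i)) → (∀ i → v i ≈ fromℚ (q i)) →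
           ⟨ u , v ⟩ ≈ fromℚ (sumℚ (zipWith ℚ._*_ p q))
⟨⟩-value {u = u} {v} {p} {q} u≈p v≈q = sum-value {x = zipWith R._*_ u v} {zipWith ℚ._*_ p q}
  λ i → *-value {u i} {v i} {p i} {q i} (u≈p i) (v≈q i)

-- Integer vectors that hold six times the coordinates.

infixl 7 _∙_

_∙_ : ∀ {n} → Vector ℤ n → Vector ℤ n → ℤ
z ∙ w = sumℤ (zipWith _*_ z w)

⅙ 1/36 : ℚ
⅙    = + 1 ℚ./ 6
1/36 = + 1 ℚ./ 36

-- The dual of A₅ has coordinates in ⅙ℤ and the dual of A₁ has them in ½ℤ, so the denominator 6
-- serves all of `L`; inner products then carry the factor 1/36.
sixths : ℤ → ℚ
sixths z = ⅙ ℚ.* (z ℚ./ 1)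

sixths-+ : ∀ z w → sixths (z + w) ≡ sixths z ℚ.+ sixths w
sixths-+ z w = trans (cong (⅙ ℚ.*_) (/1-+ z w)) (ℚ.*-distribˡ-+ ⅙ (z ℚ./ 1) (w ℚ./ 1))

sixths-neg : ∀ z → sixths (- z) ≡ ℚ.- sixths z
sixths-neg z = trans (cong (⅙ ℚ.*_) (/1-neg z)) (sym (ℚ.neg-distribʳ-* ⅙ (z ℚ./ 1)))

sixths-6* : ∀ z → sixths (+ 6 * z) ≡ z ℚ./ 1
sixths-6* z = trans (cong (⅙ ℚ.*_) (/1-* (+ 6) z))
  (trans (sym (ℚ.*-assoc ⅙ (+ 6 ℚ./ 1) (z ℚ./ 1)))
  (trans (cong (ℚ._* (z ℚ./ 1)) {⅙ ℚ.* (+ 6 ℚ./ 1)} {1ℚ} refl) (ℚ.*-identityˡ (z ℚ./ 1))))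

sixths-* : ∀ z w → sixths z ℚ.* sixths w ≡ 1/36 ℚ.* ((z * w) ℚ./ 1)
sixths-* z w = trans (interchange ⅙ (z ℚ./ 1) ⅙ (w ℚ./ 1))
  (trans (cong (ℚ._* ((z ℚ./ 1) ℚ.* (w ℚ./ 1))) {⅙ ℚ.* ⅙} {1/36} refl)
         (cong (1/36 ℚ.*_) (sym (/1-* z w))))
  where
  open CommutativeSemigroupProperties (CommutativeRing.*-commutativeSemigroup ℚ.+-*-commutativeRing)
    using (interchange)

sixths-∙ : ∀ {n} (z w : Vector ℤ n) →
           sumℚ (zipWith ℚ._*_ (sixths ∘ z) (sixths ∘ w)) ≡ 1/36 ℚ.* ((z ∙ w) ℚ./ 1)
sixths-∙ {ℕ.zero}  _ _ = refl
sixths-∙ {ℕ.suc n} z w =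
  trans (cong₂ ℚ._+_ (sixths-* (z zero) (w zero)) (sixths-∙ (tail z) (tail w)))
  (trans (sym (ℚ.*-distribˡ-+ 1/36 ((z zero * w zero) ℚ./ 1) ((tail z ∙ tail w) ℚ./ 1)))
         (cong (1/36 ℚ.*_) (sym (/1-+ (z zero * w zero) (tail z ∙ tail w)))))

1/36*36 : ∀ a → 1/36 ℚ.* ((+ 36 * a) ℚ./ 1) ≡ a ℚ./ 1
1/36*36 a = trans (cong (1/36 ℚ.*_) (/1-* (+ 36) a))
  (trans (sym (ℚ.*-assoc 1/36 (+ 36 ℚ./ 1) (a ℚ./ 1)))
  (trans (cong (ℚ._* (a ℚ./ 1)) {1/36 ℚ.* (+ 36 ℚ./ 1)} {1ℚ} refl) (ℚ.*-identityˡ (a ℚ./ 1))))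

36*1/36 : ∀ p → (+ 36 ℚ./ 1) ℚ.* (1/36 ℚ.* p) ≡ p
36*1/36 p = trans (sym (ℚ.*-assoc (+ 36 ℚ./ 1) 1/36 p))
  (trans (cong (ℚ._* p) {(+ 36 ℚ./ 1) ℚ.* 1/36} {1ℚ} refl) (ℚ.*-identityˡ p))

Sixths : ∀ {n} → ℝ^ n → Vector ℤ n → Set
Sixths u z = ∀ i → u i ≈ fromℚ (sixths (z i))

⟨⟩-sixths : ∀ {n} {u v : ℝ^ n} {z w} → Sixths u z → Sixths v w →
            ⟨ u , v ⟩ ≈ fromℚ (1/36 ℚ.* ((z ∙ w) ℚ./ 1))
⟨⟩-sixths {u = u} {v} {z} {w} u≈z v≈w =
  value-subst (⟨⟩-value {u = u} {v} {sixths ∘ z} {sixths ∘ w} u≈z v≈w) (sixths-∙ z w)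

∙⇒⟨⟩ : ∀ {n} {u v : ℝ^ n} {z w} → Sixths u z → Sixths v w →
       ∀ a → z ∙ w ≡ + 36 * a → ⟨ u , v ⟩ ≈ fromℤ a
∙⇒⟨⟩ {u = u} {v} {z} {w} u≈z v≈w a z∙w≡36a = value-subst (⟨⟩-sixths {u = u} {v} {z} {w} u≈z v≈w)
  (trans (cong (λ m → 1/36 ℚ.* (m ℚ./ 1)) z∙w≡36a) (1/36*36 a))

-- Injectivity of `fromℚ` turns an equality of reals into one of integers, where the arguments about
-- `L` take place.
⟨⟩⇒∙ : ∀ {n} {u v : ℝ^ n} {z w} → Sixths u z → Sixths v w →
       ∀ a → ⟨ u , v ⟩ ≈ fromℤ a → z ∙ w ≡ + 36 * a
⟨⟩⇒∙ {u = u} {v} {z} {w} u≈z v≈w a ⟨u,v⟩≈a = /1-injective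
  (trans (sym (36*1/36 ((z ∙ w) ℚ./ 1)))
  (trans (cong ((+ 36 ℚ./ 1) ℚ.*_) (fromℚ-injective
           (≈-trans (≈-sym (⟨⟩-sixths {u = u} {v} {z} {w} u≈z v≈w)) ⟨u,v⟩≈a)))
         (sym (/1-* (+ 36) a))))

Sixths-++ : ∀ {m n} {u : ℝ^ m} {v : ℝ^ n} {z w} → Sixths u z → Sixths v w → Sixths (u ++ v) (z ++ w)
Sixths-++ {m} u≈z v≈w i with splitAt m i
... | inj₁ j = u≈z j
... | inj₂ j = v≈w j

-- Integral coordinates on L

∙-cong : ∀ {n} {z z′ w w′ : Vector ℤ n} → z ≗ z′ → w ≗ w′ → z ∙ w ≡ z′ ∙ w′
∙-cong z≗z′ w≗w′ = sum-cong λ i → cong₂ _*_ (z≗z′ i) (w≗w′ i)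

∙-++ : ∀ {m n} (z w : Vector ℤ m) (z′ w′ : Vector ℤ n) → (z ++ z′) ∙ (w ++ w′) ≡ z ∙ w + z′ ∙ w′
∙-++ {ℕ.zero}  z w z′ w′ = sym (ℤ.+-identityˡ (z′ ∙ w′))
∙-++ {ℕ.suc m} z w z′ w′ = trans
  (cong (λ s → z zero * w zero + s) (trans (∙-cong (tail-++ z z′) (tail-++ w w′)) (∙-++ (tail z) (tail w) z′ w′)))
  (sym (ℤ.+-assoc (z zero * w zero) (tail z ∙ tail w) (z′ ∙ w′)))
  where
  tail-++ : ∀ {n} (z : Vector ℤ (ℕ.suc m)) (w : Vector ℤ n) → tail (z ++ w) ≗ tail z ++ w
  tail-++ z w i with splitAt m i
  ... | inj₁ _ = refl
  ... | inj₂ _ = refl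

++-lift₂ : ∀ {m n} (f : ℤ → ℤ → ℤ) {a b c : Vector ℤ m} {a′ b′ c′ : Vector ℤ n} →
           (∀ i → c i ≡ f (a i) (b i)) → (∀ i → c′ i ≡ f (a′ i) (b′ i)) →
           ∀ i → (c ++ c′) i ≡ f ((a ++ a′) i) ((b ++ b′) i)
++-lift₂ {m} f c≡ c′≡ i with splitAt m i
... | inj₁ j = c≡ j
... | inj₂ j = c′≡ j

blocksℤ : (z₁ z₂ z₃ : Vector ℤ 6) (z₄ z₅ z₆ z₇ : Vector ℤ 2) → Vector ℤ 26
blocksℤ z₁ z₂ z₃ z₄ z₅ z₆ z₇ = z₁ ++ z₂ ++ z₃ ++ z₄ ++ z₅ ++ z₆ ++ z₇

-- Six times the orthogonal projection of `x` to the hyperplane of sum 0.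
center : Vector ℤ 6 → Vector ℤ 6
center x i = + 6 * x i - sumℤ x

-- Six times nα₁.
pair : ℤ → Vector ℤ 2
pair n 0F = + 3 * n
pair n 1F = - (+ 3 * n)

record Param : Set where
  constructor param
  field
    x₁ x₂ x₃    : Vector ℤ 6
    h₄ h₅ h₆ h₇ : ℤ

  k₁ k₂ k₃ n₄ n₅ n₆ n₇ : ℤ
  k₁ = sumℤ x₁
  k₂ = sumℤ x₂
  k₃ = sumℤ x₃
  n₄ = k₂ + k₃ + + 2 * h₄
  n₅ = k₁ + k₃ + + 2 * h₅
  n₆ = k₁ + k₂ + + 2 * h₆
  n₇ = k₁ + k₂ + k₃ + + 2 * h₇

  -- Six times the coordinates.  Every vector of the dual lattice of A₅ is the projection of some
  -- x ∈ ℤ⁶ to the hyperplane of sum 0, with class -sumℤ x mod 6; the coset of each A₁ component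
  -- is then forced by the parities of the three classes.  The congruences mod 3 between the classes
  -- are left out, so these vectors form a lattice that contains L.
  coords : Vector ℤ 26
  coords = blocksℤ (center x₁) (center x₂) (center x₃) (pair n₄) (pair n₅) (pair n₆) (pair n₇)

open Param using (coords)

sum-neg : ∀ {n} (x : Vector ℤ n) → sumℤ (map -_ x) ≡ - sumℤ x
sum-neg {ℕ.zero}  x = refl
sum-neg {ℕ.suc n} x = trans (cong (λ s → - x zero + s) (sum-neg (tail x)))
  (sym (ℤ.neg-distrib-+ (x zero) (sumℤ (tail x))))

center-+ : ∀ x y i → center (zipWith _+_ x y) i ≡ center x i + center y i
center-+ x y i = trans (cong (λ k → + 6 * (x i + y i) - k) (sum-+ x y)) (lemma (x i) (y i) (sumℤ x) (sumℤ y))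
  where
  lemma : ∀ a b k l → + 6 * (a + b) - (k + l) ≡ + 6 * a - k + (+ 6 * b - l)
  lemma = solve-∀

center-neg : ∀ x i → center (map -_ x) i ≡ - center x i
center-neg x i = trans (cong (λ k → + 6 * (- x i) - k) (sum-neg x)) (lemma (x i) (sumℤ x))
  where
  lemma : ∀ a k → + 6 * (- a) - (- k) ≡ - (+ 6 * a - k)
  lemma = solve-∀

pair-+ : ∀ {l} m n → l ≡ m + n → ∀ i → pair l i ≡ pair m i + pair n i
pair-+ m n refl 0F = ℤ.*-distribˡ-+ (+ 3) m n
pair-+ m n refl 1F = lemma m n
  where
  lemma : ∀ m n → - (+ 3 * (m + n)) ≡ - (+ 3 * m) + - (+ 3 * n)
  lemma = solve-∀

pair-neg : ∀ {l} m → l ≡ - m → ∀ i → pair l i ≡ - pair m i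
pair-neg m refl 0F = sym (ℤ.neg-distribʳ-* (+ 3) m)
pair-neg m refl 1F = cong -_ (sym (ℤ.neg-distribʳ-* (+ 3) m))

infixl 6 _⊕_

_⊕_ : Param → Param → Param
p ⊕ q = let module P = Param p; module Q = Param q in
  param (zipWith _+_ P.x₁ Q.x₁) (zipWith _+_ P.x₂ Q.x₂) (zipWith _+_ P.x₃ Q.x₃)
        (P.h₄ + Q.h₄) (P.h₅ + Q.h₅) (P.h₆ + Q.h₆) (P.h₇ + Q.h₇)

negate : Param → Param
negate p = let module P = Param p in
  param (map -_ P.x₁) (map -_ P.x₂) (map -_ P.x₃) (- P.h₄) (- P.h₅) (- P.h₆) (- P.h₇)

coords-⊕ : ∀ p q i → coords (p ⊕ q) i ≡ coords p i + coords q i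
coords-⊕ p q =
  ++-lift₂ _+_ (center-+ P.x₁ Q.x₁) (++-lift₂ _+_ (center-+ P.x₂ Q.x₂) (++-lift₂ _+_ (center-+ P.x₃ Q.x₃)
  (++-lift₂ _+_ (pair-+ P.n₄ Q.n₄ (two P.x₂ Q.x₂ P.x₃ Q.x₃ P.h₄ Q.h₄))
  (++-lift₂ _+_ (pair-+ P.n₅ Q.n₅ (two P.x₁ Q.x₁ P.x₃ Q.x₃ P.h₅ Q.h₅))
  (++-lift₂ _+_ (pair-+ P.n₆ Q.n₆ (two P.x₁ Q.x₁ P.x₂ Q.x₂ P.h₆ Q.h₆))
                (pair-+ P.n₇ Q.n₇ (trans
                  (cong₂ (λ k l → k + l + + 2 * (P.h₇ + Q.h₇))
                    (cong₂ _+_ (sum-+ P.x₁ Q.x₁) (sum-+ P.x₂ Q.x₂)) (sum-+ P.x₃ Q.x₃))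
                  (three P.k₁ Q.k₁ P.k₂ Q.k₂ P.k₃ Q.k₃ P.h₇ Q.h₇))))))))
  where
  module P = Param p
  module Q = Param q
  two : ∀ x y x′ y′ h h′ → sumℤ (zipWith _+_ x y) + sumℤ (zipWith _+_ x′ y′) + + 2 * (h + h′) ≡
                           (sumℤ x + sumℤ x′ + + 2 * h) + (sumℤ y + sumℤ y′ + + 2 * h′)
  two x y x′ y′ h h′ = trans (cong₂ (λ k l → k + l + + 2 * (h + h′)) (sum-+ x y) (sum-+ x′ y′))
    (lemma (sumℤ x) (sumℤ y) (sumℤ x′) (sumℤ y′) h h′)
    where
    lemma : ∀ k l k′ l′ h h′ → (k + l) + (k′ + l′) + + 2 * (h + h′) ≡ (k + k′ + + 2 * h) + (l + l′ + + 2 * h′)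
    lemma = solve-∀
  three : ∀ k l k′ l′ k″ l″ h h′ → (k + l) + (k′ + l′) + (k″ + l″) + + 2 * (h + h′) ≡
                                   (k + k′ + k″ + + 2 * h) + (l + l′ + l″ + + 2 * h′)
  three = solve-∀

coords-negate : ∀ p i → coords (negate p) i ≡ - coords p i
coords-negate p =
  lift (center-neg P.x₁) (lift (center-neg P.x₂) (lift (center-neg P.x₃)
  (lift (pair-neg P.n₄ (two P.x₂ P.x₃ P.h₄))
  (lift (pair-neg P.n₅ (two P.x₁ P.x₃ P.h₅))
  (lift (pair-neg P.n₆ (two P.x₁ P.x₂ P.h₆))
        (pair-neg P.n₇ (trans
          (cong₂ (λ k l → k + l + + 2 * (- P.h₇)) (cong₂ _+_ (sum-neg P.x₁) (sum-neg P.x₂)) (sum-neg P.x₃))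
          (three P.k₁ P.k₂ P.k₃ P.h₇))))))))
  where
  module P = Param p
  lift : ∀ {m n} {a c : Vector ℤ m} {a′ c′ : Vector ℤ n} →
         (∀ i → c i ≡ - a i) → (∀ i → c′ i ≡ - a′ i) → ∀ i → (c ++ c′) i ≡ - (a ++ a′) i
  lift {a = a} {a′ = a′} = ++-lift₂ (λ z _ → - z) {a} {a} {a′ = a′} {a′}
  two : ∀ x y h → sumℤ (map -_ x) + sumℤ (map -_ y) + + 2 * (- h) ≡ - (sumℤ x + sumℤ y + + 2 * h)
  two x y h = trans (cong₂ (λ k l → k + l + + 2 * (- h)) (sum-neg x) (sum-neg y)) (lemma (sumℤ x) (sumℤ y) h)
    where
    lemma : ∀ k l h → - k + - l + + 2 * (- h) ≡ - (k + l + + 2 * h)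
    lemma = solve-∀
  three : ∀ k l m h → - k + - l + - m + + 2 * (- h) ≡ - (k + l + m + + 2 * h)
  three = solve-∀

-- Integral coordinates for every vector of L.

Sixths-blocks : ∀ {v₁ v₂ v₃ v₄ v₅ v₆ v₇ z₁ z₂ z₃ z₄ z₅ z₆ z₇} →
  Sixths v₁ z₁ → Sixths v₂ z₂ → Sixths v₃ z₃ → Sixths v₄ z₄ → Sixths v₅ z₅ → Sixths v₆ z₆ → Sixths v₇ z₇ →
  Sixths (blocks v₁ v₂ v₃ v₄ v₅ v₆ v₇) (blocksℤ z₁ z₂ z₃ z₄ z₅ z₆ z₇)
Sixths-blocks {v₁} {v₂} {v₃} {v₄} {v₅} {v₆} {v₇} {z₁} {z₂} {z₃} {z₄} {z₅} {z₆} {z₇} s₁ s₂ s₃ s₄ s₅ s₆ s₇ =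
  Sixths-++ {u = v₁} {v₂ ++ v₃ ++ v₄ ++ v₅ ++ v₆ ++ v₇} {z₁} {z₂ ++ z₃ ++ z₄ ++ z₅ ++ z₆ ++ z₇} s₁
  (Sixths-++ {u = v₂} {v₃ ++ v₄ ++ v₅ ++ v₆ ++ v₇} {z₂} {z₃ ++ z₄ ++ z₅ ++ z₆ ++ z₇} s₂
  (Sixths-++ {u = v₃} {v₄ ++ v₅ ++ v₆ ++ v₇} {z₃} {z₄ ++ z₅ ++ z₆ ++ z₇} s₃
  (Sixths-++ {u = v₄} {v₅ ++ v₆ ++ v₇} {z₄} {z₅ ++ z₆ ++ z₇} s₄
  (Sixths-++ {u = v₅} {v₆ ++ v₇} {z₅} {z₆ ++ z₇} s₅
  (Sixths-++ {u = v₆} {v₇} {z₆} {z₇} s₆ s₇)))))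

Sixths-cong : ∀ {n} {u v : ℝ^ n} {z} → u ≋ v → Sixths v z → Sixths u z
Sixths-cong u≋v v≈z i = ≈-trans (u≋v i) (v≈z i)

Sixths-≗ : ∀ {n} {u : ℝ^ n} {z w} → Sixths u z → z ≗ w → Sixths u w
Sixths-≗ u≈z z≗w i = value-subst (u≈z i) (cong sixths (z≗w i))

A₅-Sixths : ∀ {a} → a ∈ A 5 → ∃ λ x → sumℤ x ≡ 0ℤ × Sixths a (center x)
A₅-Sixths {a} (x , Σx≡0 , a≋x) = x , Σx≡0 , λ i → value-subst (a≋x i)
  (trans (sym (sixths-6* (x i))) (cong sixths
    (trans (sym (ℤ.+-identityʳ (+ 6 * x i))) (cong (λ k → + 6 * x i - k) (sym Σx≡0)))))

-- The vector (m, -m) is 2mα₁.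
A₁-Sixths : ∀ {b} → b ∈ A 1 → ∃ λ m → Sixths b (pair (+ 2 * m))
A₁-Sixths {b} (y , Σy≡0 , b≋y) = y 0F , λ where
    0F → value-subst (b≋y 0F) (trans (sym (sixths-6* (y 0F))) (cong sixths (ℤ.*-assoc (+ 3) (+ 2) (y 0F))))
    1F → value-subst (b≋y 1F) (trans (sym (sixths-6* (y 1F))) (cong sixths (trans
           (lemma (y 0F) (y 1F)) (trans (cong (λ s → + 6 * s - + 3 * (+ 2 * y 0F)) Σy≡0)
                                        (ℤ.+-identityˡ (- (+ 3 * (+ 2 * y 0F))))))))
  where
  lemma : ∀ a b → + 6 * b ≡ + 6 * (a + (b + 0ℤ)) - + 3 * (+ 2 * a)
  lemma = solve-∀

pair-cong : ∀ {m n} → m ≡ n → pair m ≗ pair n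
pair-cong refl _ = refl

Λ-param : ∀ {v} → v ∈ Λ → ∃ λ p → Sixths v (coords p)
Λ-param {v} (a , b , a∈A₅ , b∈A₁ , v≋ab)
  with x₁ , Σ₁≡0 , s₁ ← A₅-Sixths (a∈A₅ 0F) | x₂ , Σ₂≡0 , s₂ ← A₅-Sixths (a∈A₅ 1F)
     | x₃ , Σ₃≡0 , s₃ ← A₅-Sixths (a∈A₅ 2F)
     | m₄ , s₄ ← A₁-Sixths (b∈A₁ 0F) | m₅ , s₅ ← A₁-Sixths (b∈A₁ 1F)
     | m₆ , s₆ ← A₁-Sixths (b∈A₁ 2F) | m₇ , s₇ ← A₁-Sixths (b∈A₁ 3F)
  = p , Sixths-cong {u = v} {blocks (a 0F) (a 1F) (a 2F) (b 0F) (b 1F) (b 2F) (b 3F)} {coords p} v≋ab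
      (Sixths-blocks {a 0F} {a 1F} {a 2F} {b 0F} {b 1F} {b 2F} {b 3F}
         {center x₁} {center x₂} {center x₃} {pair P.n₄} {pair P.n₅} {pair P.n₆} {pair P.n₇} s₁ s₂ s₃
         (shift (b 0F) m₄ (two Σ₂≡0 Σ₃≡0) s₄)
         (shift (b 1F) m₅ (two Σ₁≡0 Σ₃≡0) s₅)
         (shift (b 2F) m₆ (two Σ₁≡0 Σ₂≡0) s₆)
         (shift (b 3F) m₇ (trans (cong₂ (λ k l → k + l + + 2 * m₇) (cong₂ _+_ Σ₁≡0 Σ₂≡0) Σ₃≡0)
                                 (ℤ.+-identityˡ (+ 2 * m₇))) s₇))
  where
  p = param x₁ x₂ x₃ m₄ m₅ m₆ m₇
  module P = Param p
  two : ∀ {k l m} → k ≡ 0ℤ → l ≡ 0ℤ → k + l + + 2 * m ≡ + 2 * m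
  two {m = m} refl refl = ℤ.+-identityˡ (+ 2 * m)
  shift : ∀ b m {n} → n ≡ + 2 * m → Sixths b (pair (+ 2 * m)) → Sixths b (pair n)
  shift b m n≡2m s = Sixths-≗ {u = b} {pair (+ 2 * m)} s (pair-cong (sym n≡2m))

-- α₅ is the projection of -e₆, and 3α₅ that of -3e₆.
e₆ : ℤ → Vector ℤ 6
e₆ m 5F = m
e₆ _ _  = 0ℤ

-- The last four entries offset the class sums, so that each of `n₄`, ..., `n₇` becomes the
-- coefficient 0 or 1 of α₁ in `β`.
β-param : Fin 4 → Param
β-param 0F = param (e₆ (- + 1)) (e₆ (- + 1)) (e₆ (- + 1)) (+ 1) (+ 1) (+ 1) (+ 2)
β-param 1F = param (e₆ (- + 3)) (e₆ 0ℤ)      (e₆ 0ℤ)      0ℤ    (+ 2) (+ 2) (+ 2)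
β-param 2F = param (e₆ 0ℤ)      (e₆ (- + 3)) (e₆ 0ℤ)      (+ 2) 0ℤ    (+ 2) (+ 2)
β-param 3F = param (e₆ 0ℤ)      (e₆ 0ℤ)      (e₆ (- + 3)) (+ 2) (+ 2) 0ℤ    (+ 2)

β-Sixths : ∀ i → Sixths (β i) (coords (β-param i))
β-Sixths = λ where
    0F → Sixths-blocks {α 5} {α 5} {α 5} {𝟎} {𝟎} {𝟎} {α 1}
           {center (e₆ (- + 1))} {center (e₆ (- + 1))} {center (e₆ (- + 1))}
           {pair 0ℤ} {pair 0ℤ} {pair 0ℤ} {pair 1ℤ} α₅ α₅ α₅ 𝟎₂ 𝟎₂ 𝟎₂ α₁
    1F → Sixths-blocks {3α₅} {𝟎} {𝟎} {𝟎} {α 1} {α 1} {α 1} {center (e₆ (- + 3))} {center (e₆ 0ℤ)} {center (e₆ 0ℤ)}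
           {pair 0ℤ} {pair 1ℤ} {pair 1ℤ} {pair 1ℤ} 3α 𝟎₆ 𝟎₆ 𝟎₂ α₁ α₁ α₁
    2F → Sixths-blocks {𝟎} {3α₅} {𝟎} {α 1} {𝟎} {α 1} {α 1} {center (e₆ 0ℤ)} {center (e₆ (- + 3))} {center (e₆ 0ℤ)}
           {pair 1ℤ} {pair 0ℤ} {pair 1ℤ} {pair 1ℤ} 𝟎₆ 3α 𝟎₆ α₁ 𝟎₂ α₁ α₁
    3F → Sixths-blocks {𝟎} {𝟎} {3α₅} {α 1} {α 1} {𝟎} {α 1} {center (e₆ 0ℤ)} {center (e₆ 0ℤ)} {center (e₆ (- + 3))}
           {pair 1ℤ} {pair 1ℤ} {pair 0ℤ} {pair 1ℤ} 𝟎₆ 𝟎₆ 3α α₁ α₁ 𝟎₂ α₁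
  where
  α₅ : Sixths (α 5) (center (e₆ (- + 1)))
  α₅ = λ where 0F → ≗⇒≈ λ _ → refl ; 1F → ≗⇒≈ λ _ → refl ; 2F → ≗⇒≈ λ _ → refl
               3F → ≗⇒≈ λ _ → refl ; 4F → ≗⇒≈ λ _ → refl ; 5F → ≗⇒≈ λ _ → refl
  3α : Sixths 3α₅ (center (e₆ (- + 3)))
  3α = λ where 0F → ≗⇒≈ λ _ → refl ; 1F → ≗⇒≈ λ _ → refl ; 2F → ≗⇒≈ λ _ → refl
               3F → ≗⇒≈ λ _ → refl ; 4F → ≗⇒≈ λ _ → refl ; 5F → ≗⇒≈ λ _ → refl
  𝟎₆ : Sixths 𝟎 (center (e₆ 0ℤ))
  𝟎₆ = λ where 0F → ≗⇒≈ λ _ → refl ; 1F → ≗⇒≈ λ _ → refl ; 2F → ≗⇒≈ λ _ → refl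
               3F → ≗⇒≈ λ _ → refl ; 4F → ≗⇒≈ λ _ → refl ; 5F → ≗⇒≈ λ _ → refl
  α₁ : Sixths (α 1) (pair 1ℤ)
  α₁ = λ where 0F → ≗⇒≈ λ _ → refl ; 1F → ≗⇒≈ λ _ → refl
  𝟎₂ : Sixths 𝟎 (pair 0ℤ)
  𝟎₂ = λ where 0F → ≗⇒≈ λ _ → refl ; 1F → ≗⇒≈ λ _ → refl

L-param : ∀ {v} → v ∈ L → ∃ λ p → Sixths v (coords p)
L-param (generator (inj₁ v∈Λ)) = Λ-param v∈Λ
L-param {v} (generator (inj₂ (i , v≋βᵢ))) =
  β-param i , Sixths-cong {u = v} {β i} {coords (β-param i)} v≋βᵢ (β-Sixths i)
-- Writing zero as a difference reduces this case to `coords-⊕` and `coords-negate`; the choice of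
-- `o` is arbitrary.
L-param 𝟎-closed = o ⊕ negate o , λ i → value-subst {0ℝ} {0ℚ} (≈-refl {0ℝ}) (cong sixths (sym
  (trans (coords-⊕ o (negate o) i)
  (trans (cong (λ z → coords o i + z) (coords-negate o i)) (ℤ.+-inverseʳ (coords o i))))))
  where o = β-param 0F
L-param (+-closed {u} {v} u∈L v∈L) with p , u≈p ← L-param u∈L | q , v≈q ← L-param v∈L =
  p ⊕ q , λ i → value-subst (+-value {u i} {v i} {sixths (coords p i)} {sixths (coords q i)} (u≈p i) (v≈q i))
    (trans (sym (sixths-+ (coords p i) (coords q i))) (cong sixths (sym (coords-⊕ p q i))))
L-param (neg-closed {v} v∈L) with p , v≈p ← L-param v∈L =
  negate p , λ i → value-subst (neg-value {v i} {sixths (coords p i)} (v≈p i))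
    (trans (sym (sixths-neg (coords p i))) (cong sixths (sym (coords-negate p i))))
L-param (≋-closed {u} {v} u≋v u∈L) with p , u≈p ← L-param u∈L =
  p , λ i → ≈-trans (≈-sym (u≋v i)) (u≈p i)

-- Splittings into two triples

∙-affine : ∀ {n} (x w : Vector ℤ n) k → (λ i → + 6 * x i - k) ∙ w ≡ + 6 * (x ∙ w) - k * sumℤ w
∙-affine {ℕ.zero}  x w k = sym (trans (ℤ.+-identityˡ (- (k * 0ℤ))) (cong -_ (ℤ.*-zeroʳ k)))
∙-affine {ℕ.suc n} x w k = trans (cong (λ s → (+ 6 * x zero - k) * w zero + s) (∙-affine (tail x) (tail w) k))
  (lemma (x zero) (w zero) k (tail x ∙ tail w) (sumℤ (tail w)))
  where
  lemma : ∀ a b k s t → (+ 6 * a - k) * b + (+ 6 * s - k * t) ≡ + 6 * (a * b + s) - k * (b + t)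
  lemma = solve-∀

∙-difference : ∀ {n} (z w : Vector ℤ n) d →
  (λ i → z i - d * w i) ∙ (λ i → z i - d * w i) ≡ z ∙ z - + 2 * d * (z ∙ w) + d * d * (w ∙ w)
∙-difference {ℕ.zero}  z w d = lemma d
  where
  lemma : ∀ d → 0ℤ ≡ 0ℤ - + 2 * d * 0ℤ + d * d * 0ℤ
  lemma = solve-∀
∙-difference {ℕ.suc n} z w d = trans
  (cong (λ s → (z zero - d * w zero) * (z zero - d * w zero) + s) (∙-difference (tail z) (tail w) d))
  (lemma (z zero) (w zero) d (tail z ∙ tail z) (tail z ∙ tail w) (tail w ∙ tail w))
  where
  lemma : ∀ a b d s t u → (a - d * b) * (a - d * b) + (s - + 2 * d * t + d * d * u) ≡
                          a * a + s - + 2 * d * (a * b + t) + d * d * (b * b + u)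
  lemma = solve-∀

square≡ : ∀ z → z * z ≡ + (∣ z ∣ ℕ.* ∣ z ∣)
square≡ (+ n)    = sym (ℤ.pos-* n n)
square≡ -[1+ n ] = refl

0≤square : ∀ z → 0ℤ ≤ z * z
0≤square z = subst (0ℤ ≤_) (sym (square≡ z)) (+≤+ ℕ.z≤n)

0≤z∙z : ∀ {n} (z : Vector ℤ n) → 0ℤ ≤ z ∙ z
0≤z∙z {ℕ.zero}  z = ℤ.≤-refl
0≤z∙z {ℕ.suc n} z = ℤ.+-mono-≤ (0≤square (z zero)) (0≤z∙z (tail z))

0≤∧+≤0 : ∀ {a b} → 0ℤ ≤ a → 0ℤ ≤ b → a + b ≤ 0ℤ → a ≡ 0ℤ × b ≡ 0ℤ
0≤∧+≤0 {a} {b} 0≤a 0≤b a+b≤0 =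
  ℤ.≤-antisym (ℤ.≤-trans (subst (_≤ a + b) (ℤ.+-identityʳ a) (ℤ.+-monoʳ-≤ a 0≤b)) a+b≤0) 0≤a ,
  ℤ.≤-antisym (ℤ.≤-trans (subst (_≤ a + b) (ℤ.+-identityˡ b) (ℤ.+-monoˡ-≤ b 0≤a)) a+b≤0) 0≤b

z∙z≤0 : ∀ {n} (z : Vector ℤ n) → z ∙ z ≤ 0ℤ → ∀ i → z i ≡ 0ℤ
z∙z≤0 {ℕ.suc n} z z∙z≤0′ with z₀²≡0 , rest≡0 ← 0≤∧+≤0 (0≤square (z zero)) (0≤z∙z (tail z)) z∙z≤0′ = λ where
  zero    → Sum.[ (λ e → e) , (λ e → e) ] (ℤ.i*j≡0⇒i≡0∨j≡0 (z zero) z₀²≡0)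
  (suc i) → z∙z≤0 (tail z) (ℤ.≤-reflexive rest≡0) i

vector₆ : ∀ {A : Set} (a b c d e f : A) → Vector A 6
vector₆ a b c d e f = λ where 0F → a ; 1F → b ; 2F → c ; 3F → d ; 4F → e ; 5F → f

-- The ten splittings of six points into two triples, each given by the triple that avoids the
-- first point.
triple : Fin 10 → Vector ℤ 6
triple 0F = vector₆ 0ℤ 1ℤ 1ℤ 1ℤ 0ℤ 0ℤ
triple 1F = vector₆ 0ℤ 1ℤ 1ℤ 0ℤ 1ℤ 0ℤ
triple 2F = vector₆ 0ℤ 1ℤ 1ℤ 0ℤ 0ℤ 1ℤ
triple 3F = vector₆ 0ℤ 1ℤ 0ℤ 1ℤ 1ℤ 0ℤ
triple 4F = vector₆ 0ℤ 1ℤ 0ℤ 1ℤ 0ℤ 1ℤ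
triple 5F = vector₆ 0ℤ 1ℤ 0ℤ 0ℤ 1ℤ 1ℤ
triple 6F = vector₆ 0ℤ 0ℤ 1ℤ 1ℤ 1ℤ 0ℤ
triple 7F = vector₆ 0ℤ 0ℤ 1ℤ 1ℤ 0ℤ 1ℤ
triple 8F = vector₆ 0ℤ 0ℤ 1ℤ 0ℤ 1ℤ 1ℤ
triple 9F = vector₆ 0ℤ 0ℤ 0ℤ 1ℤ 1ℤ 1ℤ

η : Fin 10 → Vector ℤ 6
η t i = 1ℤ - + 2 * triple t i

sum-η : ∀ t → sumℤ (η t) ≡ 0ℤ
sum-η = toWitness {a? = all? λ t → sumℤ (η t) ℤ.≟ 0ℤ} _

η∙η : ∀ t → η t ∙ η t ≡ + 6
η∙η = toWitness {a? = all? λ t → η t ∙ η t ℤ.≟ + 6} _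

-- Serves `norm≰24`, which compares two coordinates where `η t` has opposite signs.
opposite : ∀ t → ∃ λ j → η t 0F ≡ 1ℤ × η t j ≡ - 1ℤ
opposite = toWitness {a? = all? λ t → any? λ j → (η t 0F ℤ.≟ 1ℤ) ×-dec (η t j ℤ.≟ - 1ℤ)} _

-- The constant vector subtracted in `center x` is orthogonal to `η t`, whose entries sum to 0.
center∙η : ∀ x t → center x ∙ η t ≡ + 6 * (x ∙ η t)
center∙η x t = trans (∙-affine x (η t) (sumℤ x)) (trans (cong (λ s → + 6 * (x ∙ η t) - sumℤ x * s) (sum-η t))
  (lemma (+ 6 * (x ∙ η t)) (sumℤ x)))
  where
  lemma : ∀ a k → a - k * 0ℤ ≡ a
  lemma = solve-∀

-- In particular `x ∙ η t` has the parity of `sumℤ x`.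
x∙η : ∀ x t → x ∙ η t ≡ sumℤ x - + 2 * (x ∙ triple t)
x∙η x t = lemma x (triple t)
  where
  step : ∀ a b s t → a * (1ℤ - + 2 * b) + (s - + 2 * t) ≡ a + s - + 2 * (a * b + t)
  step = solve-∀
  lemma : ∀ {n} (x y : Vector ℤ n) → x ∙ (λ i → 1ℤ - + 2 * y i) ≡ sumℤ x - + 2 * (x ∙ y)
  lemma {ℕ.zero}  x y = refl
  lemma {ℕ.suc n} x y = trans (cong (λ s → x zero * (1ℤ - + 2 * y zero) + s) (lemma (tail x) (tail y)))
    (step (x zero) (y zero) (sumℤ (tail x)) (tail x ∙ tail y))

-- The vectors η t form a tight frame of the hyperplane of sum 0.
frame : ∀ x → center x ∙ center x ≡ + 3 * sumℤ (λ t → (x ∙ η t) * (x ∙ η t))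
frame x = lemma (x 0F) (x 1F) (x 2F) (x 3F) (x 4F) (x 5F)
  where
  open +-*-Solver
  Σ : ∀ {m n} → Vector (Polynomial m) n → Polynomial m
  Σ = foldr _:+_ (con 0ℤ)
  _⊙_ : ∀ {m n} → Vector (Polynomial m) n → Vector (Polynomial m) n → Polynomial m
  p ⊙ q = Σ (zipWith _:*_ p q)
  centerᴾ : ∀ {m} → Vector (Polynomial m) 6 → Vector (Polynomial m) 6
  centerᴾ p i = con (+ 6) :* p i :- Σ p
  lemma : ∀ a b c d e f → let x = vector₆ a b c d e f in
          center x ∙ center x ≡ + 3 * sumℤ (λ t → (x ∙ η t) * (x ∙ η t))
  lemma = solve 6 (λ a b c d e f → let p = vector₆ a b c d e f in
    centerᴾ p ⊙ centerᴾ p := con (+ 3) :* Σ (λ t → (p ⊙ (con ∘ η t)) :* (p ⊙ (con ∘ η t)))) refl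

-- Since `center x ∙ η t` is 6d and `η t ∙ η t` is 6, the projection of `center x` to the line of
-- `η t` is d times `η t`. The squared length of the remainder is the slack in the Cauchy-Schwarz
-- inequality.
η-bound-slack : ∀ x t → let d = x ∙ η t in
  (λ i → center x i - d * η t i) ∙ (λ i → center x i - d * η t i) ≡ center x ∙ center x - + 6 * (d * d)
η-bound-slack x t = trans (∙-difference (center x) (η t) d)
  (trans (cong₂ (λ m n → center x ∙ center x - + 2 * d * m + d * d * n) (center∙η x t) (η∙η t))
         (lemma (center x ∙ center x) d))
  where
  d = x ∙ η t
  lemma : ∀ n d → n - + 2 * d * (+ 6 * d) + d * d * + 6 ≡ n - + 6 * (d * d)
  lemma = solve-∀

η-bound : ∀ x t → + 6 * ((x ∙ η t) * (x ∙ η t)) ≤ center x ∙ center x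
η-bound x t = ℤ.0≤i-j⇒j≤i (subst (0ℤ ≤_) (η-bound-slack x t) (0≤z∙z (λ i → center x i - (x ∙ η t) * η t i)))

-- The equality case of Cauchy-Schwarz: the remainder has norm at most 0, so it vanishes.
η-bound-tight : ∀ x t → center x ∙ center x ≤ + 6 * ((x ∙ η t) * (x ∙ η t)) →
                ∀ i → center x i ≡ (x ∙ η t) * η t i
η-bound-tight x t N≤6d² i = ℤ.i-j≡0⇒i≡j (center x i) ((x ∙ η t) * η t i)
  (z∙z≤0 (λ i → center x i - (x ∙ η t) * η t i) (subst (_≤ 0ℤ) (sym (η-bound-slack x t)) (ℤ.i≤j⇒i-j≤0 N≤6d²)) i)

1≤square : ∀ z → ¬ z ≡ 0ℤ → 1ℤ ≤ z * z
1≤square (+ ℕ.zero)  z≢0 = contradiction refl z≢0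
1≤square (+ ℕ.suc n) _   = subst (1ℤ ≤_) (sym (square≡ (+ ℕ.suc n))) (+≤+ (ℕ.s≤s ℕ.z≤n))
1≤square -[1+ n ]    _   = +≤+ (ℕ.s≤s ℕ.z≤n)

sum-mono : ∀ {n} {z w : Vector ℤ n} → (∀ i → z i ≤ w i) → sumℤ z ≤ sumℤ w
sum-mono {ℕ.zero}  z≤w = ℤ.≤-refl
sum-mono {ℕ.suc n} z≤w = ℤ.+-mono-≤ (z≤w zero) (sum-mono (z≤w ∘ suc))

-- An odd sum makes all ten `x ∙ η t` odd, hence nonzero, and `frame` gives at least 3 · 10.
odd-bound : ∀ x → ¬ + 2 ∣ sumℤ x → + 30 ≤ center x ∙ center x
odd-bound x odd = subst (+ 30 ≤_) (sym (frame x))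
  (ℤ.*-monoˡ-≤-nonNeg (+ 3) (sum-mono {10} {replicate 10 1ℤ} λ t → 1≤square (x ∙ η t) λ x∙η≡0 →
    odd (divides (x ∙ triple t) (trans (ℤ.i-j≡0⇒i≡j (sumℤ x) (+ 2 * (x ∙ triple t)) (trans (sym (x∙η x t)) x∙η≡0))
                                       (ℤ.*-comm (+ 2) (x ∙ triple t))))))

-- Vectors of L of norm 3

-- As 24 = 6d², the vector `center x` would equal d times `η t`. Two of its coordinates would then
-- differ by 2d, but differences of its coordinates are multiples of 6, and 36 does not divide 4d² =
-- 16.
norm≰24 : ∀ x t → (x ∙ η t) * (x ∙ η t) ≡ + 4 → ¬ center x ∙ center x ≤ + 24
norm≰24 x t d²≡4 N≤24 with j , η₀≡1 , ηⱼ≡-1 ← opposite t =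
  from-no (+ 36 ∣? + 16) (divides (y * y) (begin
    + 16                              ≡⟨ cong (+ 4 *_) d²≡4 ⟨
    + 4 * (d * d)                     ≡⟨ double d ⟩
    (d * 1ℤ - d * - 1ℤ) * (d * 1ℤ - d * - 1ℤ)  ≡⟨ cong (λ e → e * e) 2d≡6y ⟩
    (+ 6 * y) * (+ 6 * y)             ≡⟨ square y ⟩
    y * y * + 36                      ∎))
  where
  open ≡-Reasoning
  d = x ∙ η t
  y = x 0F - x j
  tight = η-bound-tight x t (subst (λ e → center x ∙ center x ≤ + 6 * e) (sym d²≡4) N≤24)
  double : ∀ d → + 4 * (d * d) ≡ (d * 1ℤ - d * - 1ℤ) * (d * 1ℤ - d * - 1ℤ)
  double = solve-∀
  square : ∀ y → (+ 6 * y) * (+ 6 * y) ≡ y * y * + 36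
  square = solve-∀
  difference : ∀ a b k → + 6 * a - k - (+ 6 * b - k) ≡ + 6 * (a - b)
  difference = solve-∀
  2d≡6y : d * 1ℤ - d * - 1ℤ ≡ + 6 * y
  2d≡6y = trans (cong₂ (λ e f → d * e - d * f) (sym η₀≡1) (sym ηⱼ≡-1))
    (trans (cong₂ _-_ (sym (tight 0F)) (sym (tight j))) (difference (x 0F) (x j) (sumℤ x)))

if-≤ : ∀ {P : Set} {a b c} (P? : Dec P) → (P → a ≤ c) → (¬ P → b ≤ c) → (if does P? then a else b) ≤ c
if-≤ (yes p) a≤c _   = a≤c p
if-≤ (no ¬p) _   b≤c = b≤c ¬p

parityBound : ℤ → ℤ
parityBound m = if does (+ 2 ∣? m) then 0ℤ else + 30

parityBound≤ : ∀ x m h → m ≡ sumℤ x + h * + 2 → parityBound m ≤ center x ∙ center x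
parityBound≤ x m h m≡k+2h = if-≤ (+ 2 ∣? m) (λ _ → 0≤z∙z (center x)) λ odd →
  odd-bound x λ 2∣k → odd (subst (+ 2 ∣_) (sym m≡k+2h) (∣m∣n⇒∣m+n 2∣k (divides h refl)))

-- The value 25 for d² = 4 matters: with 24, the case d = 2, n₄ = 1, n₅ = 1, n₆ = 0 would meet the
-- limit exactly, as 24 + 30 + 18 + 18 = 90.
normBound : ℤ → ℤ
normBound d = + 6 * (d * d) ⊔ (parityBound d ⊔ (if does (d * d ℤ.≟ + 4) then + 25 else 0ℤ))

normBound≤ : ∀ x t → normBound (x ∙ η t) ≤ center x ∙ center x
normBound≤ x t = ℤ.⊔-lub (η-bound x t) (ℤ.⊔-lub
  (parityBound≤ x (x ∙ η t) (- (x ∙ triple t)) (trans (x∙η x t) (lemma (sumℤ x) (x ∙ triple t))))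
  25≤)
  where
  lemma : ∀ k y → k - + 2 * y ≡ k + - y * + 2
  lemma = solve-∀
  25≤ : (if does ((x ∙ η t) * (x ∙ η t) ℤ.≟ + 4) then + 25 else 0ℤ) ≤ center x ∙ center x
  25≤ = if-≤ ((x ∙ η t) * (x ∙ η t) ℤ.≟ + 4) (λ d²≡4 → ℤ.i<j⇒suc[i]≤j (ℤ.≰⇒> (norm≰24 x t d²≡4)))
                                              (λ _ → 0≤z∙z (center x))

-- The finite case check for d, n₄, n₅, n₆.

sgn : Fin 2 → ℤ
sgn 0F = 1ℤ
sgn 1F = - 1ℤ

-- The two values of d + n₄ stand for (u, w) = 1 and (u, w) = 0.
Near : ℤ → ℤ → Set
Near d n₄ = d + n₄ ≡ 1ℤ ⊎ d + n₄ ≡ - 1ℤ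

-- The exceptional vectors: v₁ = ±½η has (v₁, η) = ±3. The signs `a` and `b` are taken relative to
-- `s`, so that together they form the colour.
Far : ℤ → ℤ → ℤ → ℤ → Set
Far d n₄ n₅ n₆ = ∃ λ s → ∃ λ a → ∃ λ b →
  d ≡ sgn s * + 3 × n₄ ≡ 0ℤ × n₅ ≡ sgn s * sgn a × n₆ ≡ sgn s * sgn b

-- In the application d is (v₁, η), so that d + n₄ = 2(u, w) - 1, and nᵢ is 2aᵢ; the lower bound is
-- one for 36(u - ½ρ, u - ½ρ) = 90.
lowerBound : (d n₄ n₅ n₆ : ℤ) → ℤ
lowerBound d n₄ n₅ n₆ = normBound d + (parityBound (d + n₆) + (parityBound (d + n₅) +
  (+ 18 * (n₄ * n₄) + (+ 18 * (n₅ * n₅) + + 18 * (n₆ * n₆)))))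

NearOrFar : (d n₄ n₅ n₆ : ℤ) → Set
NearOrFar d n₄ n₅ n₆ = lowerBound d n₄ n₅ n₆ ≤ + 90 → ¬ + 2 ∣ d + n₄ → ¬ + 2 ∣ d + n₅ + n₆ →
  Near d n₄ ⊎ Far d n₄ n₅ n₆

nearOrFar? : ∀ d n₄ n₅ n₆ → Dec (NearOrFar d n₄ n₅ n₆)
nearOrFar? d n₄ n₅ n₆ = (lowerBound d n₄ n₅ n₆ ℤ.≤? + 90) →-dec (¬? (+ 2 ∣? d + n₄) →-dec (¬? (+ 2 ∣? d + n₅ + n₆) →-dec
  (((d + n₄ ℤ.≟ 1ℤ) ⊎-dec (d + n₄ ℤ.≟ - 1ℤ)) ⊎-dec
   any? λ s → any? λ a → any? λ b → (d ℤ.≟ sgn s * + 3) ×-dec (n₄ ℤ.≟ 0ℤ) ×-dec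
     (n₅ ℤ.≟ sgn s * sgn a) ×-dec (n₆ ℤ.≟ sgn s * sgn b))))

-- Enumerates |d| < 4 and |nᵢ| < 3 by sign and absolute value, with 0 occurring under both signs.
nearOrFar-table : ∀ (s₁ : Fin 2) (f₁ : Fin 4) (s₄ : Fin 2) (f₄ : Fin 3)
                    (s₅ : Fin 2) (f₅ : Fin 3) (s₆ : Fin 2) (f₆ : Fin 3) →
  NearOrFar (sgn s₁ * + toℕ f₁) (sgn s₄ * + toℕ f₄) (sgn s₅ * + toℕ f₅) (sgn s₆ * + toℕ f₆)
nearOrFar-table = toWitness {a? = all? λ s₁ → all? λ f₁ → all? λ s₄ → all? λ f₄ → all? λ s₅ → all? λ f₅ →
  all? λ s₆ → all? λ f₆ → nearOrFar? (sgn s₁ * + toℕ f₁) (sgn s₄ * + toℕ f₄) (sgn s₅ * + toℕ f₅) (sgn s₆ * + toℕ f₆)} _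

signed : ∀ z n → ∣ z ∣ ℕ.< n → ∃ λ s → ∃ λ (f : Fin n) → z ≡ sgn s * + toℕ f
signed (+ m)    n m<n = 0F , fromℕ< m<n ,
  trans (cong +_ (sym (toℕ-fromℕ< m<n))) (sym (ℤ.*-identityˡ (+ toℕ (fromℕ< m<n))))
signed -[1+ m ] n m+1<n = 1F , fromℕ< m+1<n ,
  trans (cong (λ k → - (+ k)) (sym (toℕ-fromℕ< m+1<n))) (sym (ℤ.-1*i≡-i (+ toℕ (fromℕ< m+1<n))))

square-small : ∀ c r z → 90 ℕ.< c ℕ.* (r ℕ.* r) → + c * (z * z) ≤ + 90 → ∣ z ∣ ℕ.< r
square-small c r z 90<cr² cz²≤90 = ℕ.≰⇒> λ r≤∣z∣ → ℕ.<⇒≱ 90<cr² (ℕ.≤-trans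
  (ℕ.*-monoʳ-≤ c (ℕ.*-mono-≤ r≤∣z∣ r≤∣z∣))
  (ℤ.drop‿+≤+ (subst (_≤ + 90) (trans (cong (+ c *_) (square≡ z)) (sym (ℤ.pos-* c (∣ z ∣ ℕ.* ∣ z ∣)))) cz²≤90)))

nearOrFar : ∀ d n₄ n₅ n₆ → ∣ d ∣ ℕ.< 4 → ∣ n₄ ∣ ℕ.< 3 → ∣ n₅ ∣ ℕ.< 3 → ∣ n₆ ∣ ℕ.< 3 → NearOrFar d n₄ n₅ n₆
nearOrFar d n₄ n₅ n₆ d< n₄< n₅< n₆<
  with s₁ , f₁ , refl ← signed d 4 d< | s₄ , f₄ , refl ← signed n₄ 3 n₄<
     | s₅ , f₅ , refl ← signed n₅ 3 n₅< | s₆ , f₆ , refl ← signed n₆ 3 n₆<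
  = nearOrFar-table s₁ f₁ s₄ f₄ s₅ f₅ s₆ f₆

-- Inner products of block vectors.

zeros : ∀ {n} → Vector ℤ n
zeros _ = 0ℤ

∙-zeros : ∀ {n} (z : Vector ℤ n) → z ∙ zeros ≡ 0ℤ
∙-zeros {ℕ.zero}  z = refl
∙-zeros {ℕ.suc n} z = cong₂ _+_ (ℤ.*-zeroʳ (z zero)) (∙-zeros (tail z))

∙-scale : ∀ {n} (z w : Vector ℤ n) c → z ∙ (λ i → c * w i) ≡ c * (z ∙ w)
∙-scale {ℕ.zero}  z w c = sym (ℤ.*-zeroʳ c)
∙-scale {ℕ.suc n} z w c = trans (cong (λ s → z zero * (c * w zero) + s) (∙-scale (tail z) (tail w) c))
  (lemma (z zero) (w zero) c (tail z ∙ tail w))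
  where
  lemma : ∀ a b c s → a * (c * b) + c * s ≡ c * (a * b + s)
  lemma = solve-∀

pair∙pair : ∀ m n → pair m ∙ pair n ≡ + 18 * (m * n)
pair∙pair m n = lemma m n
  where
  lemma : ∀ m n → + 3 * m * (+ 3 * n) + (- (+ 3 * m) * - (+ 3 * n) + 0ℤ) ≡ + 18 * (m * n)
  lemma = solve-∀

first : Vector ℤ 2
first 0F = + 6
first 1F = 0ℤ

pair∙first : ∀ n → pair n ∙ first ≡ + 18 * n
pair∙first n = lemma n
  where
  lemma : ∀ n → + 3 * n * + 6 + (- (+ 3 * n) * 0ℤ + 0ℤ) ≡ + 18 * n
  lemma = solve-∀

blocks∙blocks : ∀ z₁ z₂ z₃ z₄ z₅ z₆ z₇ w₁ w₂ w₃ w₄ w₅ w₆ w₇ →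
  blocksℤ z₁ z₂ z₃ z₄ z₅ z₆ z₇ ∙ blocksℤ w₁ w₂ w₃ w₄ w₅ w₆ w₇ ≡
  z₁ ∙ w₁ + (z₂ ∙ w₂ + (z₃ ∙ w₃ + (z₄ ∙ w₄ + (z₅ ∙ w₅ + (z₆ ∙ w₆ + z₇ ∙ w₇)))))
blocks∙blocks z₁ z₂ z₃ z₄ z₅ z₆ z₇ w₁ w₂ w₃ w₄ w₅ w₆ w₇ =
  step z₁ w₁ {z₂ ++ z₃ ++ z₄ ++ z₅ ++ z₆ ++ z₇} {w₂ ++ w₃ ++ w₄ ++ w₅ ++ w₆ ++ w₇}
  (step z₂ w₂ {z₃ ++ z₄ ++ z₅ ++ z₆ ++ z₇} {w₃ ++ w₄ ++ w₅ ++ w₆ ++ w₇}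
  (step z₃ w₃ {z₄ ++ z₅ ++ z₆ ++ z₇} {w₄ ++ w₅ ++ w₆ ++ w₇}
  (step z₄ w₄ {z₅ ++ z₆ ++ z₇} {w₅ ++ w₆ ++ w₇}
  (step z₅ w₅ {z₆ ++ z₇} {w₆ ++ w₇}
  (∙-++ z₆ w₆ z₇ w₇)))))
  where
  step : ∀ {m n} (z w : Vector ℤ m) {z′ w′ : Vector ℤ n} {s} → z′ ∙ w′ ≡ s → (z ++ z′) ∙ (w ++ w′) ≡ z ∙ w + s
  step z w {z′} {w′} eq = trans (∙-++ z w z′ w′) (cong (λ s → z ∙ w + s) eq)

blocks-cong : ∀ {z₁ z₂ z₃ z₄ z₅ z₆ z₇ w₁ w₂ w₃ w₄ w₅ w₆ w₇} →
  z₁ ≗ w₁ → z₂ ≗ w₂ → z₃ ≗ w₃ → z₄ ≗ w₄ → z₅ ≗ w₅ → z₆ ≗ w₆ → z₇ ≗ w₇ →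
  blocksℤ z₁ z₂ z₃ z₄ z₅ z₆ z₇ ≗ blocksℤ w₁ w₂ w₃ w₄ w₅ w₆ w₇
blocks-cong {z₁} {z₂} {z₃} {z₄} {z₅} {z₆} {z₇} {w₁} {w₂} {w₃} {w₄} {w₅} {w₆} {w₇} e₁ e₂ e₃ e₄ e₅ e₆ e₇ =
  ++-cong z₁ w₁ e₁ (++-cong z₂ w₂ e₂ (++-cong z₃ w₃ e₃ (++-cong z₄ w₄ e₄ (++-cong z₅ w₅ e₅ (++-cong z₆ w₆ e₆ e₇)))))

sgn-square : ∀ s a → (sgn s * sgn a) * (sgn s * sgn a) ≡ 1ℤ
sgn-square = toWitness {a? = all? λ s → all? λ a → (sgn s * sgn a) * (sgn s * sgn a) ℤ.≟ 1ℤ} _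

+-cong₇ : ∀ {a b c d e f g a′ b′ c′ d′ e′ f′ g′ : ℤ} →
  a ≡ a′ → b ≡ b′ → c ≡ c′ → d ≡ d′ → e ≡ e′ → f ≡ f′ → g ≡ g′ →
  a + (b + (c + (d + (e + (f + g))))) ≡ a′ + (b′ + (c′ + (d′ + (e′ + (f′ + g′)))))
+-cong₇ refl refl refl refl refl refl refl = refl

ρℤ : Vector ℤ 26
ρℤ = blocksℤ zeros zeros zeros (pair 0ℤ) (pair 0ℤ) (pair 0ℤ) (pair (+ 2))

-- Six times the vector (1_S - ½, 0, 0, (1, 0), 0, 0, α₁).  In the fourth block it is the sum of α₁
-- and a vector (½, ½) orthogonal to L, so it is not in L.
wℤ : Fin 10 → Vector ℤ 26
wℤ t = blocksℤ (λ i → + 3 * η t i) zeros zeros first (pair 0ℤ) (pair 0ℤ) (pair 1ℤ)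

farℤ : Fin 10 → (s a b : Fin 2) → Vector ℤ 26
farℤ t s a b = blocksℤ (λ i → sgn s * + 3 * η t i) zeros zeros
                       (pair 0ℤ) (pair (sgn s * sgn a)) (pair (sgn s * sgn b)) (pair 1ℤ)

coords∙coords : ∀ p → let open Param p hiding (coords) in coords p ∙ coords p ≡
  center x₁ ∙ center x₁ + (center x₂ ∙ center x₂ + (center x₃ ∙ center x₃ +
  (+ 18 * (n₄ * n₄) + (+ 18 * (n₅ * n₅) + (+ 18 * (n₆ * n₆) + + 18 * (n₇ * n₇))))))
coords∙coords p = trans
  (blocks∙blocks (center x₁) (center x₂) (center x₃) (pair n₄) (pair n₅) (pair n₆) (pair n₇)
                 (center x₁) (center x₂) (center x₃) (pair n₄) (pair n₅) (pair n₆) (pair n₇))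
  (+-cong₇ {center x₁ ∙ center x₁} {center x₂ ∙ center x₂} {center x₃ ∙ center x₃}
    refl refl refl (pair∙pair n₄ n₄) (pair∙pair n₅ n₅) (pair∙pair n₆ n₆) (pair∙pair n₇ n₇))
  where open Param p hiding (coords)

coords∙ρ : ∀ p → coords p ∙ ρℤ ≡ + 36 * Param.n₇ p
coords∙ρ p = trans
  (blocks∙blocks (center x₁) (center x₂) (center x₃) (pair n₄) (pair n₅) (pair n₆) (pair n₇)
                 zeros zeros zeros (pair 0ℤ) (pair 0ℤ) (pair 0ℤ) (pair (+ 2)))
  (trans (+-cong₇ (∙-zeros (center x₁)) (∙-zeros (center x₂)) (∙-zeros (center x₃))
                  (pair∙pair n₄ 0ℤ) (pair∙pair n₅ 0ℤ) (pair∙pair n₆ 0ℤ) (pair∙pair n₇ (+ 2)))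
         (lemma n₄ n₅ n₆ n₇))
  where
  open Param p hiding (coords)
  lemma : ∀ a b c d → 0ℤ + (0ℤ + (0ℤ + (+ 18 * (a * 0ℤ) +
          (+ 18 * (b * 0ℤ) + (+ 18 * (c * 0ℤ) + + 18 * (d * + 2)))))) ≡ + 36 * d
  lemma = solve-∀

coords∙w : ∀ p t → let open Param p hiding (coords) in coords p ∙ wℤ t ≡ + 18 * (x₁ ∙ η t + n₄ + n₇)
coords∙w p t = trans
  (blocks∙blocks (center x₁) (center x₂) (center x₃) (pair n₄) (pair n₅) (pair n₆) (pair n₇)
                 (λ i → + 3 * η t i) zeros zeros first (pair 0ℤ) (pair 0ℤ) (pair 1ℤ))
  (trans (+-cong₇ (trans (∙-scale (center x₁) (η t) (+ 3)) (cong (+ 3 *_) (center∙η x₁ t)))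
                  (∙-zeros (center x₂)) (∙-zeros (center x₃))
                  (pair∙first n₄) (pair∙pair n₅ 0ℤ) (pair∙pair n₆ 0ℤ) (pair∙pair n₇ 1ℤ))
         (lemma (x₁ ∙ η t) n₄ n₅ n₆ n₇))
  where
  open Param p hiding (coords)
  lemma : ∀ d n₄ n₅ n₆ n₇ → + 3 * (+ 6 * d) + (0ℤ + (0ℤ + (+ 18 * n₄ +
          (+ 18 * (n₅ * 0ℤ) + (+ 18 * (n₆ * 0ℤ) + + 18 * (n₇ * 1ℤ)))))) ≡ + 18 * (d + n₄ + n₇)
  lemma = solve-∀

-- Vectors of norm 3 are orthogonal to w, have product 1 with it, or are exceptional.

module Classification (p : Param) (norm : coords p ∙ coords p ≡ + 108) (affine : coords p ∙ ρℤ ≡ + 36)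
                      (t : Fin 10) where
  open Param p hiding (coords)

  n₇≡1 : n₇ ≡ 1ℤ
  n₇≡1 = ℤ.*-cancelˡ-≡ (+ 36) n₇ 1ℤ (trans (sym (coords∙ρ p)) affine)

  d N₁ N₂ N₃ E₄ E₅ E₆ : ℤ
  d  = x₁ ∙ η t
  N₁ = center x₁ ∙ center x₁
  N₂ = center x₂ ∙ center x₂
  N₃ = center x₃ ∙ center x₃
  E₄ = + 18 * (n₄ * n₄)
  E₅ = + 18 * (n₅ * n₅)
  E₆ = + 18 * (n₆ * n₆)

  -- The last block is α₁ by `n₇≡1` and takes 18 of the scaled norm 36 · 3 = 108.
  total : N₁ + (N₂ + (N₃ + (E₄ + (E₅ + E₆)))) ≡ + 90
  total = trans (regroup N₁ N₂ N₃ E₄ E₅ E₆ (+ 18 * (n₇ * n₇)))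
    (cong₂ _-_ (trans (sym (coords∙coords p)) norm) (cong (λ n → + 18 * (n * n)) n₇≡1))
    where
    regroup : ∀ a b c d e f g → a + (b + (c + (d + (e + f)))) ≡ a + (b + (c + (d + (e + (f + g))))) - g
    regroup = solve-∀

  0≤18n² : ∀ n → 0ℤ ≤ + 18 * (n * n)
  0≤18n² n = ℤ.*-monoˡ-≤-nonNeg (+ 18) (0≤square n)

  bounded : ∀ {a b c d e f} → a ≤ N₁ → b ≤ N₂ → c ≤ N₃ → d ≤ E₄ → e ≤ E₅ → f ≤ E₆ →
            a + (b + (c + (d + (e + f)))) ≤ + 90
  bounded a≤ b≤ c≤ d≤ e≤ f≤ = subst (_ ≤_) total
    (ℤ.+-mono-≤ a≤ (ℤ.+-mono-≤ b≤ (ℤ.+-mono-≤ c≤ (ℤ.+-mono-≤ d≤ (ℤ.+-mono-≤ e≤ f≤)))))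

  0≤N₁ = 0≤z∙z (center x₁)
  0≤N₂ = 0≤z∙z (center x₂)
  0≤N₃ = 0≤z∙z (center x₃)

  d-small : ∣ d ∣ ℕ.< 4
  -- Here 6 · 4² = 96 exceeds 90; for the nᵢ below, 18 · 3² = 162 does.
  d-small = square-small 6 4 d (toWitness {a? = 90 ℕ.<? 96} _) (subst (_≤ + 90) (ℤ.+-identityʳ (+ 6 * (d * d)))
    (bounded (η-bound x₁ t) 0≤N₂ 0≤N₃ (0≤18n² n₄) (0≤18n² n₅) (0≤18n² n₆)))

  n-small : ∀ n → + 18 * (n * n) ≤ + 90 → ∣ n ∣ ℕ.< 3
  n-small n = square-small 18 3 n (toWitness {a? = 90 ℕ.<? 162} _)

  n₄-small : ∣ n₄ ∣ ℕ.< 3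
  n₄-small = n-small n₄ (subst (_≤ + 90) (trans (ℤ.+-identityˡ _) (trans (ℤ.+-identityˡ _) (trans (ℤ.+-identityˡ _)
      (ℤ.+-identityʳ E₄))))
    (bounded 0≤N₁ 0≤N₂ 0≤N₃ ℤ.≤-refl (0≤18n² n₅) (0≤18n² n₆)))

  n₅-small : ∣ n₅ ∣ ℕ.< 3
  n₅-small = n-small n₅ (subst (_≤ + 90) (trans (ℤ.+-identityˡ _) (trans (ℤ.+-identityˡ _) (trans (ℤ.+-identityˡ _)
      (trans (ℤ.+-identityˡ _) (ℤ.+-identityʳ E₅)))))
    (bounded 0≤N₁ 0≤N₂ 0≤N₃ (0≤18n² n₄) ℤ.≤-refl (0≤18n² n₆)))

  n₆-small : ∣ n₆ ∣ ℕ.< 3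
  n₆-small = n-small n₆ (subst (_≤ + 90) (trans (ℤ.+-identityˡ _) (trans (ℤ.+-identityˡ _) (trans (ℤ.+-identityˡ _)
      (trans (ℤ.+-identityˡ _) (ℤ.+-identityˡ E₆)))))
    (bounded 0≤N₁ 0≤N₂ 0≤N₃ (0≤18n² n₄) (0≤18n² n₅) ℤ.≤-refl))

  y : ℤ
  y = x₁ ∙ triple t

  odd : ∀ {m} h → m ≡ 1ℤ + h * + 2 → ¬ + 2 ∣ m
  odd h m≡1+2h 2∣m = from-no (+ 2 ∣? 1ℤ) (∣m+n∣n⇒∣m (subst (+ 2 ∣_) m≡1+2h 2∣m) (divides h refl))

  near-or-far : Near d n₄ ⊎ Far d n₄ n₅ n₆
  near-or-far = nearOrFar d n₄ n₅ n₆ d-small n₄-small n₅-small n₆-small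
    -- Modulo 2, d is k₁, so d + n₆ is k₂ and d + n₅ is k₃, while d + n₄ and d + n₅ + n₆ both agree
    -- with n₇ = 1.
    (bounded (normBound≤ x₁ t)
             (parityBound≤ x₂ (d + n₆) (k₁ + h₆ - y) (trans (cong (_+ n₆) (x∙η x₁ t)) (parity₂ k₁ k₂ y h₆)))
             (parityBound≤ x₃ (d + n₅) (k₁ + h₅ - y) (trans (cong (_+ n₅) (x∙η x₁ t)) (parity₂ k₁ k₃ y h₅)))
             ℤ.≤-refl ℤ.≤-refl ℤ.≤-refl)
    (odd (h₄ - y - h₇) (trans (cong (_+ n₄) (x∙η x₁ t))
      (trans (parity₄ k₁ k₂ k₃ y h₄ h₇) (cong (_+ (h₄ - y - h₇) * + 2) n₇≡1))))
    (odd (k₁ + h₅ + h₆ - y - h₇) (trans (cong (λ e → e + n₅ + n₆) (x∙η x₁ t))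
      (trans (parity₅₆ k₁ k₂ k₃ y h₅ h₆ h₇) (cong (_+ (k₁ + h₅ + h₆ - y - h₇) * + 2) n₇≡1))))
    where
    parity₂ : ∀ k l y h → k - + 2 * y + (k + l + + 2 * h) ≡ l + (k + h - y) * + 2
    parity₂ = solve-∀
    parity₄ : ∀ k l m y h h′ → k - + 2 * y + (l + m + + 2 * h) ≡ k + l + m + + 2 * h′ + (h - y - h′) * + 2
    parity₄ = solve-∀
    parity₅₆ : ∀ k l m y h h′ h″ → k - + 2 * y + (k + m + + 2 * h) + (k + l + + 2 * h′) ≡
                                   k + l + m + + 2 * h″ + (k + h + h′ - y - h″) * + 2
    parity₅₆ = solve-∀

  near⇒∙w : Near d n₄ → coords p ∙ wℤ t ≡ 0ℤ ⊎ coords p ∙ wℤ t ≡ + 36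
  near⇒∙w = Sum.swap ∘ Sum.map
    (λ d+n₄≡1 → trans (coords∙w p t) (cong₂ (λ a b → + 18 * (a + b)) d+n₄≡1 n₇≡1))
    (λ d+n₄≡-1 → trans (coords∙w p t) (cong₂ (λ a b → + 18 * (a + b)) d+n₄≡-1 n₇≡1))

  -- The total 90 is used up: the first block needs at least 6 · 3² = 54 and the fifth and sixth
  -- take 18 each. So the bound on the first block is tight and the second and third blocks vanish.
  far⇒≗ : Far d n₄ n₅ n₆ → ∃ λ s → ∃ λ a → ∃ λ b → coords p ≗ farℤ t s a b
  far⇒≗ (s , a , b , d≡3s , n₄≡0 , n₅≡sa , n₆≡sb) = s , a , b ,
    blocks-cong {center x₁} {center x₂} {center x₃} {pair n₄} {pair n₅} {pair n₆} {pair n₇}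
      (λ i → trans (η-bound-tight x₁ t N₁≤6d² i) (cong (_* η t i) d≡3s))
      (z∙z≤0 (center x₂) (ℤ.≤-reflexive (proj₁ N₂₃≡0))) (z∙z≤0 (center x₃) (ℤ.≤-reflexive (proj₂ N₂₃≡0)))
      (pair-cong n₄≡0) (pair-cong n₅≡sa) (pair-cong n₆≡sb) (pair-cong n₇≡1)
    where
    E≡36 : E₄ + (E₅ + E₆) ≡ + 36
    E≡36 = trans (cong₂ (λ m e → + 18 * (m * m) + e) n₄≡0 (cong₂ (λ m n → + 18 * (m * m) + + 18 * (n * n)) n₅≡sa n₆≡sb))
      (cong₂ (λ m n → 0ℤ + (+ 18 * m + + 18 * n)) (sgn-square s a) (sgn-square s b))
    6d²≡54 : + 6 * (d * d) ≡ + 54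
    6d²≡54 = trans (cong (λ e → + 6 * (e * e)) d≡3s) (6·9≡54 s)
      where
      6·9≡54 : ∀ s → + 6 * ((sgn s * + 3) * (sgn s * + 3)) ≡ + 54
      6·9≡54 0F = refl
      6·9≡54 1F = refl
    N₁≤6d² : N₁ ≤ + 6 * (d * d)
    N₁≤6d² = subst (N₁ ≤_) (sym 6d²≡54) (ℤ.i-j≤0⇒i≤j (subst (_≤ 0ℤ) (shift N₁)
      (ℤ.i≤j⇒i-j≤0 (bounded ℤ.≤-refl 0≤N₂ 0≤N₃ (ℤ.≤-refl {E₄}) (ℤ.≤-refl {E₅}) (ℤ.≤-refl {E₆})))))
      where
      shift : ∀ N → N + (0ℤ + (0ℤ + (E₄ + (E₅ + E₆)))) - + 90 ≡ N - + 54
      shift N = trans (cong (λ e → N + (0ℤ + (0ℤ + e)) - + 90) E≡36) (lemma N)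
        where
        lemma : ∀ N → N + (0ℤ + (0ℤ + + 36)) - + 90 ≡ N - + 54
        lemma = solve-∀
    N₂₃≡0 : N₂ ≡ 0ℤ × N₃ ≡ 0ℤ
    N₂₃≡0 = 0≤∧+≤0 0≤N₂ 0≤N₃ (subst (_≤ 0ℤ) (shift N₂ N₃) (ℤ.i≤j⇒i-j≤0
      (bounded (η-bound x₁ t) (ℤ.≤-refl {N₂}) (ℤ.≤-refl {N₃}) (ℤ.≤-refl {E₄}) (ℤ.≤-refl {E₅}) (ℤ.≤-refl {E₆}))))
      where
      shift : ∀ M N → + 6 * (d * d) + (M + (N + (E₄ + (E₅ + E₆)))) - + 90 ≡ M + N
      shift M N = trans (cong₂ (λ f e → f + (M + (N + e)) - + 90) 6d²≡54 E≡36) (lemma M N)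
        where
        lemma : ∀ M N → + 54 + (M + (N + + 36)) - + 90 ≡ M + N
        lemma = solve-∀

-- With ε the product of the signs `s` and `s′`, the first block contributes 18ε, the fifth and
-- sixth 18ε each and the last 18; the total is 18 + 54ε.
far∙far : ∀ t t′ s s′ a b → η t ∙ η t′ ≡ + 2 →
          farℤ t s a b ∙ farℤ t′ s′ a b ≡ + 72 ⊎ farℤ t s a b ∙ farℤ t′ s′ a b ≡ - + 36
far∙far = toWitness {a? = all? λ t → all? λ t′ → all? λ s → all? λ s′ → all? λ a → all? λ b →
  (η t ∙ η t′ ℤ.≟ + 2) →-dec
  ((farℤ t s a b ∙ farℤ t′ s′ a b ℤ.≟ + 72) ⊎-dec (farℤ t s a b ∙ farℤ t′ s′ a b ℤ.≟ - + 36))} _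

-- Colouring the splittings

-- The edge of `t` joins the two points other than the first that lie outside its triple. Distinct
-- edges give the product 2 if they share a vertex and -2 if they are disjoint.
Meet : Fin 10 → Fin 10 → Set
Meet t t′ = η t ∙ η t′ ≡ + 2

meet? : ∀ t t′ → Dec (Meet t t′)
meet? t t′ = η t ∙ η t′ ℤ.≟ + 2

-- The ten splittings correspond to the edges of K₅ and Meet says that two edges share one vertex:
-- there are no three disjoint edges.
two-of-three-meet : ∀ i j k → i Fin.< j → j Fin.< k → Meet i j ⊎ Meet i k ⊎ Meet j k
two-of-three-meet = toWitness {a? = all? λ i → all? λ j → all? λ k →
  (i Fin.<? j) →-dec ((j Fin.<? k) →-dec (meet? i j ⊎-dec (meet? i k ⊎-dec meet? j k)))} _

-- Attach to each k a bit telling whether its value occurred before. If j < k agree in value and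
-- bit, then j witnesses the bit of k, so the bit of j is set too and provides i.
pigeonhole₃ : ∀ {m n} → m ℕ.* 2 ℕ.< n → (c : Fin n → Fin m) →
              ∃ λ i → ∃ λ j → ∃ λ k → i Fin.< j × j Fin.< k × c i ≡ c j × c j ≡ c k
pigeonhole₃ {m} {n} 2m<n c =
  let j , k , j<k , fⱼ≡fₖ = Fin.pigeonhole 2m<n (λ k → combine (c k) (flag (repeated? k)))
      cⱼ≡cₖ , flags≡ = Fin.combine-injective (c j) (flag (repeated? j)) (c k) (flag (repeated? k)) fⱼ≡fₖ
      i , i<j , cᵢ≡cⱼ = flag-transfer (repeated? k) (repeated? j) (sym flags≡) (j , j<k , cⱼ≡cₖ)
  in i , j , k , i<j , j<k , cᵢ≡cⱼ , cⱼ≡cₖ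
  where
  repeated? : ∀ k → Dec (∃ λ i → i Fin.< k × c i ≡ c k)
  repeated? k = any? λ i → (i Fin.<? k) ×-dec (c i Fin.≟ c k)
  flag : ∀ {P : Set} → Dec P → Fin 2
  flag P? = if does P? then 1F else 0F
  flag-transfer : ∀ {P Q : Set} (P? : Dec P) (Q? : Dec Q) → flag P? ≡ flag Q? → P → Q
  flag-transfer (yes _) (yes q) _ _ = q
  flag-transfer (no ¬p) _       _ p = contradiction p ¬p

-- As 10 > 4 · 2, three edges have one colour, and three edges of K₅ are never pairwise disjoint.
same-colour-meet : (c : Fin 10 → Fin 4) → ∃ λ t → ∃ λ t′ → c t ≡ c t′ × Meet t t′
same-colour-meet c = pick (pigeonhole₃ (toWitness {a? = 8 ℕ.<? 10} _) c)
  where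
  pick : (∃ λ i → ∃ λ j → ∃ λ k → i Fin.< j × j Fin.< k × c i ≡ c j × c j ≡ c k) →
         ∃ λ t → ∃ λ t′ → c t ≡ c t′ × Meet t t′
  pick (i , j , k , i<j , j<k , cᵢ≡cⱼ , cⱼ≡cₖ) = Sum.[ (λ ij → i , j , cᵢ≡cⱼ , ij) ,
    Sum.[ (λ ik → i , k , trans cᵢ≡cⱼ cⱼ≡cₖ , ik) , (λ jk → j , k , cⱼ≡cₖ , jk) ]′ ]′ (two-of-three-meet i j k i<j j<k)

-- Enlarging an affine equiangular set by w.

ρ-Sixths : Sixths ρ ρℤ
ρ-Sixths = Sixths-blocks {𝟎} {𝟎} {𝟎} {𝟎} {𝟎} {𝟎} {fromℤ (+ 2) · α 1} {zeros} {zeros} {zeros}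
  {pair 0ℤ} {pair 0ℤ} {pair 0ℤ} {pair (+ 2)}
  𝟎₆ 𝟎₆ 𝟎₆ 𝟎₂ 𝟎₂ 𝟎₂ 2α₁
  where
  𝟎₆ : Sixths {6} 𝟎 zeros
  𝟎₆ _ = ≗⇒≈ λ _ → refl
  𝟎₂ : Sixths 𝟎 (pair 0ℤ)
  𝟎₂ = λ where 0F → ≗⇒≈ λ _ → refl ; 1F → ≗⇒≈ λ _ → refl
  2α₁ : Sixths (fromℤ (+ 2) · α 1) (pair (+ 2))
  2α₁ = λ where 0F → ≗⇒≈ λ _ → refl ; 1F → ≗⇒≈ λ _ → refl

w : Fin 10 → ℝ^ 26
w t i = fromℚ (sixths (wℤ t i))

w∙w : ∀ t → wℤ t ∙ wℤ t ≡ + 108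
w∙w = toWitness {a? = all? λ t → wℤ t ∙ wℤ t ℤ.≟ + 108} _

w∙ρ : ∀ t → wℤ t ∙ ρℤ ≡ + 36
w∙ρ = toWitness {a? = all? λ t → wℤ t ∙ ρℤ ℤ.≟ + 36} _

∙-comm : ∀ {n} (z w : Vector ℤ n) → z ∙ w ≡ w ∙ z
∙-comm z w = sum-cong λ i → ℤ.*-comm (z i) (w i)

ZeroOne : ℤ → Set
ZeroOne m = m ≡ 0ℤ ⊎ m ≡ + 36

zeroOne? : ∀ m → Dec (ZeroOne m)
zeroOne? m = (m ℤ.≟ 0ℤ) ⊎-dec (m ℤ.≟ + 36)

zeroOne⇒⟨⟩ : ∀ {n} {u v : ℝ^ n} {z w} → Sixths u z → Sixths v w → ZeroOne (z ∙ w) → ⟨ u , v ⟩ ≈ 0ℝ ⊎ ⟨ u , v ⟩ ≈ 1ℝ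
zeroOne⇒⟨⟩ {u = u} {v} {z} {w} u≈z v≈w = Sum.map
  (λ z∙w≡0  → value-subst {⟨ u , v ⟩} {0ℤ ℚ./ 1} {0ℚ} (∙⇒⟨⟩ {u = u} {v} {z} {w} u≈z v≈w 0ℤ z∙w≡0) refl)
  (λ z∙w≡36 → value-subst {⟨ u , v ⟩} {1ℤ ℚ./ 1} {1ℚ} (∙⇒⟨⟩ {u = u} {v} {z} {w} u≈z v≈w 1ℤ z∙w≡36) refl)

⟨⟩⇒zeroOne : ∀ {n} {u v : ℝ^ n} {z w} → Sixths u z → Sixths v w → ⟨ u , v ⟩ ≈ 0ℝ ⊎ ⟨ u , v ⟩ ≈ 1ℝ → ZeroOne (z ∙ w)
⟨⟩⇒zeroOne {u = u} {v} {z} {w} u≈z v≈w = Sum.map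
  (λ ⟨⟩≈0 → ⟨⟩⇒∙ {u = u} {v} {z} {w} u≈z v≈w 0ℤ (value-subst {⟨ u , v ⟩} {0ℚ} {0ℤ ℚ./ 1} ⟨⟩≈0 refl))
  (λ ⟨⟩≈1 → ⟨⟩⇒∙ {u = u} {v} {z} {w} u≈z v≈w 1ℤ (value-subst {⟨ u , v ⟩} {1ℚ} {1ℤ ℚ./ 1} ⟨⟩≈1 refl))

≋-sym : ∀ {n} {u v : ℝ^ n} → u ≋ v → v ≋ u
≋-sym u≋v i = ≈-sym (u≋v i)

≋-trans : ∀ {n} {u v x : ℝ^ n} → u ≋ v → v ≋ x → u ≋ x
≋-trans u≋v v≋x i = ≈-trans (u≋v i) (v≋x i)

id-isIsometricEmbedding : ∀ {n} → IsIsometricEmbedding {n} {n} (λ v → v)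
id-isIsometricEmbedding = record
  { cong-≋       = λ u≋v → u≋v
  ; +-homo       = λ _ _ _ → ≈-refl
  ; ·-homo       = λ _ _ _ → ≈-refl
  ; ⟨⟩-preserved = λ _ _ → ≈-refl
  }

zeroOne-or-far : ∀ {u} p t → Sixths u (coords p) → ⟨ u , u ⟩ ≈ fromℤ (+ 3) → ⟨ u , ρ ⟩ ≈ 1ℝ →
              ZeroOne (coords p ∙ wℤ t) ⊎ ∃ λ s → ∃ λ a → ∃ λ b → Sixths u (farℤ t s a b)
zeroOne-or-far {u} p t u≈p ⟨u,u⟩≈3 ⟨u,ρ⟩≈1 = Sum.map near⇒∙w
  (λ far → let s , a , b , p≗far = far⇒≗ far in s , a , b , Sixths-≗ {u = u} {coords p} u≈p p≗far) near-or-far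
  where
  open Classification p
    (⟨⟩⇒∙ {u = u} {u} {coords p} {coords p} u≈p u≈p (+ 3) ⟨u,u⟩≈3)
    (⟨⟩⇒∙ {u = u} {ρ} {coords p} {ρℤ} u≈p ρ-Sixths 1ℤ (value-subst {⟨ u , ρ ⟩} {1ℚ} {1ℤ ℚ./ 1} ⟨u,ρ⟩≈1 refl)) t

module Extension (ω : Pred (ℝ^ 26) 0ℓ) (ω-isAffineEquiangular : IsAffineEquiangular ρ ω) (ω⊆L : ω ⊆ L) where
  open IsAffineEquiangular ω-isAffineEquiangular

  -- The obstruction to adding `w t`: an exceptional vector for `t` inside `ω`.
  FarFrom : Fin 10 → Set
  FarFrom t = ∃ λ u → u ∈ ω × ∃ λ s → ∃ λ a → ∃ λ b → Sixths u (farℤ t s a b)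

  near-w : ∀ {u t} → ¬ FarFrom t → u ∈ ω → ∃ λ z → Sixths u z × ZeroOne (z ∙ wℤ t)
  near-w {u} {t} ¬far u∈ω = near (L-param (ω⊆L u∈ω))
    where
    near : (∃ λ p → Sixths u (coords p)) → ∃ λ z → Sixths u z × ZeroOne (z ∙ wℤ t)
    near (p , u≈p) = coords p , u≈p , Sum.fromInj₁
      (λ (s , a , b , u≈far) → contradiction (u , u∈ω , s , a , b , u≈far) ¬far)
      (zeroOne-or-far {u} p t u≈p (norm {u} u∈ω) (affine {u} u∈ω))

  -- Used to refute equalities of vectors: two integer representations of one vector of `ω` must
  -- have product 108.
  Sixths-norm : ∀ {u} z z′ → u ∈ ω → Sixths u z → Sixths u z′ → z ∙ z′ ≡ + 108
  Sixths-norm {u} z z′ u∈ω u≈z u≈z′ = ⟨⟩⇒∙ {u = u} {u} {z} {z′} u≈z u≈z′ (+ 3) (norm {u} u∈ω)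

  not-all-far : ¬ (∀ t → FarFrom t)
  not-all-far far =
    let t , t′ , same , meet = same-colour-meet λ t → combine (colour₁ t) (colour₂ t)
        a≡ , b≡ = Fin.combine-injective (colour₁ t) (colour₂ t) (colour₁ t′) (colour₂ t′) same
        s  , u≈z  = sign t
        s′ , v≈z″ = sign t′
        u = proj₁ (far t)
        v = proj₁ (far t′)
        u∈ω = proj₁ (proj₂ (far t))
        v∈ω = proj₁ (proj₂ (far t′))
        z  = farℤ t s (colour₁ t) (colour₂ t)
        z′ = farℤ t′ s′ (colour₁ t) (colour₂ t)
        -- Equality of colours rewrites the second vector with the signs of the first, as `far∙far`
        -- requires.
        v≈z′ = subst₂ (λ a b → Sixths v (farℤ t′ s′ a b)) (sym a≡) (sym b≡) v≈z″
        z∙z′ = far∙far t t′ s s′ (colour₁ t) (colour₂ t) meet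
        u≉v : ¬ u ≋ v
        u≉v u≋v = not-108 z∙z′ (Sixths-norm {u} z z′ u∈ω u≈z (Sixths-cong {u = u} {v} {z′} u≋v v≈z′))
    in not-zeroOne z∙z′ (⟨⟩⇒zeroOne {u = u} {v} {z} {z′} u≈z v≈z′ (distinct {u} {v} u∈ω v∈ω u≉v))
    where
    colour₁ colour₂ : Fin 10 → Fin 2
    colour₁ t = let _ , _ , _ , a , _ = far t in a
    colour₂ t = let _ , _ , _ , _ , b , _ = far t in b
    sign : ∀ t → ∃ λ s → Sixths (proj₁ (far t)) (farℤ t s (colour₁ t) (colour₂ t))
    sign t = let _ , _ , s , _ , _ , u≈z = far t in s , u≈z
    not-108 : ∀ {m} → m ≡ + 72 ⊎ m ≡ - + 36 → ¬ m ≡ + 108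
    not-108 (inj₁ refl) ()
    not-108 (inj₂ refl) ()
    not-zeroOne : ∀ {m} → m ≡ + 72 ⊎ m ≡ - + 36 → ¬ ZeroOne m
    not-zeroOne (inj₁ refl) = from-no (zeroOne? (+ 72))
    not-zeroOne (inj₂ refl) = from-no (zeroOne? (- + 36))

  module _ (t : Fin 10) (¬far : ¬ FarFrom t) where

    extension : Pred (ℝ^ 26) 0ℓ
    extension v = v ∈ ω ⊎ v ≋ w t

    extension-distinct : ∀ {u v} → u ∈ extension → v ∈ extension → ¬ u ≋ v → ⟨ u , v ⟩ ≈ 0ℝ ⊎ ⟨ u , v ⟩ ≈ 1ℝ
    extension-distinct {u} {v} (inj₁ u∈ω) (inj₁ v∈ω) = distinct {u} {v} u∈ω v∈ω
    extension-distinct {u} {v} (inj₁ u∈ω) (inj₂ v≋w) _ = let z , u≈z , z∙w = near-w {u} {t} ¬far u∈ω in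
      zeroOne⇒⟨⟩ {u = u} {v} {z} {wℤ t} u≈z v≋w z∙w
    extension-distinct {u} {v} (inj₂ u≋w) (inj₁ v∈ω) _ = let z , v≈z , z∙w = near-w {v} {t} ¬far v∈ω in
      zeroOne⇒⟨⟩ {u = u} {v} {wℤ t} {z} u≋w v≈z (subst ZeroOne (∙-comm z (wℤ t)) z∙w)
    extension-distinct {u} {v} (inj₂ u≋w) (inj₂ v≋w) u≉v =
      contradiction (≋-trans {u = u} {w t} {v} u≋w (≋-sym {u = v} {w t} v≋w)) u≉v

    extension-isAffineEquiangular : IsAffineEquiangular ρ extension
    extension-isAffineEquiangular = record
      { respects = λ {u} {v} u≋v → Sum.map (respects {u} {v} u≋v) (≋-trans {u = v} {u} {w t} (≋-sym {u = u} {v} u≋v))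
      ; affine   = λ {u} → Sum.[ affine {u} , (λ u≋w → value-subst {⟨ u , ρ ⟩} {1ℤ ℚ./ 1} {1ℚ}
                     (∙⇒⟨⟩ {u = u} {ρ} {wℤ t} {ρℤ} u≋w ρ-Sixths 1ℤ (w∙ρ t)) refl) ]′
      ; norm     = λ {u} → Sum.[ norm {u} , (λ u≋w → ∙⇒⟨⟩ {u = u} {u} {wℤ t} {wℤ t} u≋w u≋w (+ 3) (w∙w t)) ]′
      ; distinct = λ {u} {v} → extension-distinct {u} {v}
      }

    -- The inclusion is strict: if `w t` were in `ω`, then `near-w` would force its scaled norm 108
    -- to be 0 or 36.
    ω⊂extension : image (λ v → v) ω ⊂ extension
    ω⊂extension = (λ {v} (u , u∈ω , v≋u) → inj₁ (respects {u} {v} (≋-sym {u = v} {u} v≋u) u∈ω)) , λ extension⊆ω →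
      let u , u∈ω , w≋u = extension⊆ω {w t} (inj₂ λ _ → ≈-refl)
          z , u≈z , z∙w = near-w {u} {t} ¬far u∈ω
      in from-no (zeroOne? (+ 108)) (subst ZeroOne (Sixths-norm {u} z (wℤ t) u∈ω u≈z (≋-sym {u = w t} {u} w≋u)) z∙w)

theorem8p1 : (ω : Pred (ℝ^ 26) 0ℓ) → IsMaximumIn L ρ ω → ¬ StronglyMaximal ρ ω
theorem8p1 ω ω-isMaximum stronglyMaximal = Fin.sequence (RawMonad.rawApplicative ¬¬-Monad) {P = FarFrom}
  -- `FarFrom t` is not decidable, so strong maximality yields only its double negation. As there
  -- are ten splittings, the double negations combine into that of the universal statement.
  (λ t ¬far → stronglyMaximal 26 (λ v → v) id-isIsometricEmbedding
    (extension t ¬far , extension-isAffineEquiangular t ¬far , ω⊂extension t ¬far))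
  not-all-far
  where
  open IsMaximumIn ω-isMaximum
  open Extension ω isAffineEquiangular ω⊆L
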